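{- There is an algorithm which, given a nonnegative $n\times m$ integer matrix $A$ with no zero column and a vector $y\in\mathbb{Z}^n$, computes the number of integer points in the polytope $P(y)=\{x\in\mathbb{R}^m : Ax=y,\ x\ge 0\}$, i.e. $|P(y)\cap\mathbb{Z}^m|$, in $O(\mathrm{poly}(n,m,\|y\|_\infty)\,(\|y\|_\infty+1)^n)$ time and $O(\mathrm{poly}(n,m,\|y\|_\infty))$ space.
   Context: $\|y\|_\infty=\max_i|y_i|$. $\mathrm{poly}(\cdot)$ denotes some fixed polynomial in the listed quantities, independent of the input. -}

module Defs where

open import Data.Fin.Base using (Fin)
open import Data.Integer.Base as ℤ using (ℤ; +_; -[1+_]; 0ℤ; ∣_∣)
open import Data.List.Base as List using (List; []; _∷_; _++_)
open import Data.Nat.Base using (ℕ; zero; suc; _+_; _*_; _⊔_; _⊓_)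
open import Data.Nat.ListAction using (sum)
open import Data.Nat.Logarithm using (⌈log₂_⌉)
open import Data.Nat.Solver using (module +-*-Solver)
open import Data.Product.Base using (_×_)
open import Data.Refinement using (Refinement)
open import Data.Vec.Base as Vec using (Vec; []; _∷_)
open import Data.Vec.Relation.Unary.All using (All)
open import Function.Bundles using (_↔_)
open import Relation.Binary.PropositionalEquality.Core using (_≡_)
open import Relation.Nullary.Negation.Core using (¬_)

Matrix : ℕ → ℕ → Set
Matrix n m = Vec (Vec ℤ m) n

entry : ∀ {n m} → Matrix n m → Fin n → Fin m → ℤ
entry A i j = Vec.lookup (Vec.lookup A i) j

NonNegative : ∀ {n m} → Matrix n m → Set
NonNegative A = ∀ i j → 0ℤ ℤ.≤ entry A i j

NoZeroColumn : ∀ {n m} → Matrix n m → Set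
NoZeroColumn A = ∀ j → ¬ (∀ i → entry A i j ≡ 0ℤ)

_∙_ : ∀ {m} → Vec ℤ m → Vec ℤ m → ℤ
u ∙ v = Vec.foldr′ ℤ._+_ 0ℤ (Vec.zipWith ℤ._*_ u v)

_·ᵥ_ : ∀ {n m} → Matrix n m → Vec ℤ m → Vec ℤ n
A ·ᵥ x = Vec.map (_∙ x) A

‖_‖∞ : ∀ {n} → Vec ℤ n → ℕ
‖ y ‖∞ = Vec.foldr′ (λ z M → ∣ z ∣ ⊔ M) 0 y

-- P(y) ∩ ℤᵐ, as a predicate on ℤᵐ.
IntegerPoint : ∀ {n m} → Matrix n m → Vec ℤ n → Vec ℤ m → Set
IntegerPoint A y x = (A ·ᵥ x ≡ y) × All (0ℤ ℤ.≤_) x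

HasCardinality : {X : Set} → (X → Set) → ℕ → Set
HasCardinality {X} P c = Fin c ↔ Refinement X P

-- Polynomials with coefficients in ℕ; the library interprets the negation
-- of this syntax as the identity, so every expression denotes such a
-- polynomial.
open +-*-Solver public using () renaming (Polynomial to Poly)

eval₃ : Poly 3 → ℕ → ℕ → ℕ → ℕ
eval₃ p a b c = +-*-Solver.⟦ p ⟧ (a ∷ b ∷ c ∷ [])

------------------------------------------------------------------------
-- Random access machine with logarithmic (bit) cost.
--
-- The work memory is an array of integers, initially empty, with indirect
-- addressing.  The input is a second, read-only, random access array that
-- does not count as space.  Programs are structured rather than given by
-- jumps.

-- A sign bit and ⌈log₂ (1 + |z|)⌉ binary digits.
size : ℤ → ℕ
size z = suc ⌈log₂ suc ∣ z ∣ ⌉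

Memory : Set
Memory = List ℤ

-- Cells that were never written contain 0.
read : Memory → ℕ → ℤ
read []      _       = 0ℤ
read (z ∷ σ) zero    = z
read (z ∷ σ) (suc k) = read σ k

-- Writing beyond the end allocates all the cells in between.
write : Memory → ℕ → ℤ → Memory
write []      zero    v = v ∷ []
write []      (suc k) v = 0ℤ ∷ write [] k v
write (z ∷ σ) zero    v = v ∷ σ
write (z ∷ σ) (suc k) v = z ∷ write σ k v

memorySize : Memory → ℕ
memorySize σ = sum (List.map size σ)

-- `via k` is the address held in work cell k (up to sign).
data Address : Set where
  at via : ℕ → Address

data Operand : Set where
  lit   : ℤ → Operand
  work  : Address → Operand
  input : Address → Operand

data Op : Set where
  add sub mul div : Op

infix  5 _≔_⟨_⟩_
infixr 4 _⨾_

data Program : Set where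
  skip             : Program
  _≔_⟨_⟩_          : Address → Operand → Op → Operand → Program
  _⨾_              : Program → Program → Program
  if_≤_then_else_  : Operand → Operand → Program → Program → Program
  while_≤_loop_    : Operand → Operand → Program → Program

-- Division is Euclidean (remainder in [0, |b|)), with a / 0 = 0.
apply : Op → ℤ → ℤ → ℤ
apply add a b          = a ℤ.+ b
apply sub a b          = a ℤ.- b
apply mul a b          = a ℤ.* b
apply div a (+ 0)      = 0ℤ
apply div a b@(+ suc _)  = a ℤ./ b
apply div a b@(-[1+ _ ]) = a ℤ./ b

-- Schoolbook bit complexity.
opTime : Op → ℤ → ℤ → ℕ
opTime add a b = size a + size b
opTime sub a b = size a + size b
opTime mul a b = size a * size b
opTime div a b = size a * size b

resolve : Memory → Address → ℕ
resolve σ (at k)  = k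
resolve σ (via k) = ∣ read σ k ∣

addressTime : Memory → Address → ℕ
addressTime σ (at k)  = size (+ k)
addressTime σ (via k) = size (+ k) + size (read σ k)

-- Integers are stored least significant digit first and self-delimited, so
-- two of them can be compared while reading only as many digits of the
-- longer one as the shorter one has.
compareTime : ℤ → ℤ → ℕ
compareTime a b = size a ⊓ size b

module Semantics (inp : List ℤ) where

  value : Memory → Operand → ℤ
  value σ (lit z)   = z
  value σ (work a)  = read σ (resolve σ a)
  value σ (input a) = read inp (resolve σ a)

  operandTime : Memory → Operand → ℕ
  operandTime σ (lit z)   = 0
  operandTime σ (work a)  = addressTime σ a
  operandTime σ (input a) = addressTime σ a

  testTime : Memory → Operand → Operand → ℕ
  testTime σ a b = operandTime σ a + operandTime σ b + compareTime (value σ a) (value σ b)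

  testSpace : Memory → Operand → Operand → ℕ
  testSpace σ a b = memorySize σ + compareTime (value σ a) (value σ b)

  update : Memory → Address → Operand → Op → Operand → Memory
  update σ d a o b = write σ (resolve σ d) (apply o (value σ a) (value σ b))

  -- Terminating runs of a program; the rules are deterministic.
  data Run : Program → Memory → Memory → Set where
    skip    : ∀ {σ} → Run skip σ σ
    assign  : ∀ {σ d a o b} → Run (d ≔ a ⟨ o ⟩ b) σ (update σ d a o b)
    seq     : ∀ {p q ρ σ τ} → Run p ρ σ → Run q σ τ → Run (p ⨾ q) ρ τ
    if-yes  : ∀ {a b p q σ τ} → value σ a ℤ.≤ value σ b → Run p σ τ →
              Run (if a ≤ b then p else q) σ τ
    if-no   : ∀ {a b p q σ τ} → ¬ (value σ a ℤ.≤ value σ b) → Run q σ τ →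
              Run (if a ≤ b then p else q) σ τ
    loop    : ∀ {a b p ρ σ τ} → value ρ a ℤ.≤ value ρ b → Run p ρ σ →
              Run (while a ≤ b loop p) σ τ → Run (while a ≤ b loop p) ρ τ
    stop    : ∀ {a b p σ} → ¬ (value σ a ℤ.≤ value σ b) →
              Run (while a ≤ b loop p) σ σ

  time : ∀ {p σ τ} → Run p σ τ → ℕ
  time skip = 1
  time (assign {σ} {d} {a} {o} {b}) =
    addressTime σ d + operandTime σ a + operandTime σ b + opTime o (value σ a) (value σ b)
  time (seq r s)                    = time r + time s
  time (if-yes {a} {b} {σ = σ} _ r) = testTime σ a b + time r
  time (if-no  {a} {b} {σ = σ} _ r) = testTime σ a b + time r
  time (loop {a} {b} {ρ = ρ} _ r s) = testTime ρ a b + time r + time s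
  time (stop {a} {b} {σ = σ} _)     = testTime σ a b

  -- Peak number of bits in use.  During an operation the operands are
  -- additionally held in scratch registers.
  space : ∀ {p σ τ} → Run p σ τ → ℕ
  space (skip {σ}) = memorySize σ
  space (assign {σ} {d} {a} {o} {b}) =
    (memorySize σ + size (value σ a) + size (value σ b)) ⊔ memorySize (update σ d a o b)
  space (seq r s)                    = space r ⊔ space s
  space (if-yes {a} {b} {σ = σ} _ r) = testSpace σ a b ⊔ space r
  space (if-no  {a} {b} {σ = σ} _ r) = testSpace σ a b ⊔ space r
  space (loop {a} {b} {ρ = ρ} _ r s) = testSpace ρ a b ⊔ space r ⊔ space s
  space (stop {a} {b} {σ = σ} _)     = testSpace σ a b

open Semantics public using (Run; time; space)

-- n, m, the entries of A row by row, then the entries of y.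
encode : ∀ {n m} → Matrix n m → Vec ℤ n → List ℤ
encode {n} {m} A y = + n ∷ + m ∷ Vec.toList (Vec.concat A) ++ Vec.toList y

-- A halting computation on the given input that leaves its result in cell 0.
record Computation (prog : Program) (inp : List ℤ) (result : ℤ) : Set where
  field
    {final} : Memory
    run     : Run inp prog [] final
    output  : read final 0 ≡ result

  runTime runSpace : ℕ
  runTime  = time inp run
  runSpace = space inp run

open Computation public using (runTime; runSpace)

{-# OPTIONS --safe #-}
module Submission where

-- Let M = ‖y‖∞ and N = M + 1.  A column is nonzero, so integer points have coordinates at most M, and
-- entries of A exceeding N may be replaced by N.  For nonnegative y the number of points is therefore
-- the coefficient c of z^y in the polynomial f(z) = ∏ⱼ ∑_{x<N} (∏ᵢ zᵢ^aᵢⱼ)^x.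
--
-- With β(y,k) = (-1)ᵏ (y choose k), finite differences give ∑ₖ β(y,k) (-k)^e = 0 for e < y and = y! for
-- e = y.  Hence only the monomials divisible by z^y contribute to T = ∑_k (∏ᵢ β(yᵢ,kᵢ)) f(-k₁X,…,-kₙX),
-- the sum over k ∈ {0,…,M}ⁿ, and T = P (D c + X U) with D = ∏ᵢ yᵢ!, P = ∏ᵢ X^yᵢ and some integer U.
-- For X = D Y and Y = 2 N^m > c this determines c = ((T / P) / D) mod Y.
--
-- The sum has Nⁿ summands, the index k being the n digits in base N of a counter K, and all the
-- numbers involved have polynomially many bits.

-- The obstacle is space. Dynamic programming over right-hand sides keeps a table of Nⁿ counts, and
-- a Kronecker substitution that isolates the coefficient in a single evaluation needs numbers of
-- about Nⁿ bits. A sum over a grid of short evaluations needs neither: one summand is alive at a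
-- time. Two mechanisms remove the unwanted monomials. If some exponent is below yᵢ, the finite
-- difference in that variable vanishes. If none is below and some is above, the common scale X of
-- the nodes leaves a spare factor X, so the monomial disappears modulo X. Nothing has to be known
-- about f beyond its being a polynomial with integer coefficients. Neither bound of the theorem
-- mentions the size of the entries of A. This is why entries are truncated, and why a long entry
-- may be compared but never be copied or multiplied. Time and space are proved together with
-- correctness: each loop has an invariant which bounds the bits of its accumulator, and each
-- program fragment has a polynomial number of elementary steps. The sum over the grid is the one
-- loop whose number of rounds is not polynomial.

open import Data.Bool.Base using (true; false)
open import Data.Fin.Base as Fin using (Fin; toℕ; fromℕ<)
open import Data.Fin using (#_)
import Data.Fin.Properties as Fin
open import Data.Integer.Base as ℤ using (ℤ; +_; -[1+_]; 0ℤ; 1ℤ; ∣_∣)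
import Data.Integer.DivMod as ℤ
import Data.Integer.Properties as ℤ
open import Data.Integer.Tactic.RingSolver using (solve-∀)
import Data.Irrelevant as Irrelevant
open import Data.List.Base as List using (List; []; _∷_; _++_; length; downFrom; cartesianProductWith; filter)
import Data.List.Properties as List
open import Data.List.Membership.Propositional using (_∈_)
open import Data.List.Membership.Propositional.Properties using (∈-lookup; ∈-map⁺; ∈-map⁻; ∈-filter⁺; ∈-filter⁻; ∈-cartesianProductWith⁺; ∈-downFrom⁺)
open import Data.List.Relation.Unary.All as All using (All; []; _∷_)
open import Data.List.Relation.Unary.Any as Any using (here)
import Data.List.Relation.Unary.Any.Properties as Any
open import Data.List.Relation.Unary.Unique.Propositional using (Unique; []; _∷_)
import Data.List.Relation.Unary.Unique.Propositional.Properties as Unique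
open import Data.Nat.Base using (ℕ; zero; suc; _+_; _*_; _^_; _≤_; _<_; z≤n; s≤s; _⊔_; _⊓_; _∸_; _!; NonZero; >-nonZero; ≢-nonZero)
import Data.Nat.Divisibility as ℕ using (n∣m*n)
import Data.Nat.DivMod as ℕ
open import Data.Nat.Logarithm using (⌈log₂_⌉; ⌈log₂⌉-mono-≤; ⌈log₂2^n⌉≡n)
import Data.Nat.Properties as ℕ
open import Data.Nat.Solver using (module +-*-Solver)
open +-*-Solver using (con; var; _:+_; _:*_)
import Data.Nat.Tactic.RingSolver as ℕ using (solve-∀)
open import Data.Product.Base using (∃; ∃₂; _×_; _,_; proj₁; proj₂)
open import Data.Refinement using (Refinement; value-injective)
open import Data.Sum.Base using (_⊎_; inj₁; inj₂)
open import Data.Unit.Base using (tt)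
open import Data.Vec.Base as Vec using (Vec; []; _∷_)
import Data.Vec.Properties as Vec
import Data.Vec.Relation.Unary.All as Vec∀
open import Function.Base using (_∘_; id; case_of_)
open import Function.Bundles using (mk↔ₛ′)
open import Relation.Binary.Definitions using (tri<; tri≈; tri>)
open import Relation.Binary.PropositionalEquality using (_≡_; _≢_; refl; sym; trans; cong; cong₂; subst; module ≡-Reasoning)
open import Relation.Nullary.Decidable using (Dec; yes; no; _because_; True; toWitness; _×-dec_; recompute)
open import Relation.Nullary.Negation using (¬_; contradiction)
open import Defs

-- Finite sums and products of integers

∑∈ : ∀ {A : Set} → List A → (A → ℤ) → ℤ
∑∈ []       f = 0ℤ
∑∈ (x ∷ xs) f = f x ℤ.+ ∑∈ xs f

∑ : ℕ → (ℕ → ℤ) → ℤ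
∑ n = ∑∈ (downFrom n)

∏ : ℕ → (ℕ → ℤ) → ℤ
∏ zero    f = 1ℤ
∏ (suc n) f = f n ℤ.* ∏ n f

+-interchange : ∀ a b c d → (a ℤ.+ b) ℤ.+ (c ℤ.+ d) ≡ (a ℤ.+ c) ℤ.+ (b ℤ.+ d)
+-interchange = solve-∀

i+j-j≡i : ∀ i j → (i ℤ.+ j) ℤ.- j ≡ i
i+j-j≡i = solve-∀

*-swap : ∀ a b c → a ℤ.* (b ℤ.* c) ≡ b ℤ.* (a ℤ.* c)
*-swap = solve-∀

*-interchange : ∀ a b c d → (a ℤ.* b) ℤ.* (c ℤ.* d) ≡ (a ℤ.* c) ℤ.* (b ℤ.* d)
*-interchange = solve-∀

∑∈-cong : ∀ {A : Set} {f g : A → ℤ} xs → (∀ x → f x ≡ g x) → ∑∈ xs f ≡ ∑∈ xs g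
∑∈-cong []       eq = refl
∑∈-cong (x ∷ xs) eq = cong₂ ℤ._+_ (eq x) (∑∈-cong xs eq)

∑∈-distribˡ : ∀ {A : Set} c (xs : List A) f → ∑∈ xs (λ x → c ℤ.* f x) ≡ c ℤ.* ∑∈ xs f
∑∈-distribˡ c []       f = sym (ℤ.*-zeroʳ c)
∑∈-distribˡ c (x ∷ xs) f =
  trans (cong (ℤ._+_ (c ℤ.* f x)) (∑∈-distribˡ c xs f)) (sym (ℤ.*-distribˡ-+ c (f x) (∑∈ xs f)))

∑∈-+ : ∀ {A : Set} (xs : List A) f g → ∑∈ xs (λ x → f x ℤ.+ g x) ≡ ∑∈ xs f ℤ.+ ∑∈ xs g
∑∈-+ []       f g = refl
∑∈-+ (x ∷ xs) f g =
  trans (cong (ℤ._+_ (f x ℤ.+ g x)) (∑∈-+ xs f g)) (+-interchange (f x) (g x) (∑∈ xs f) (∑∈ xs g))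

∑∈-0 : ∀ {A : Set} (xs : List A) → ∑∈ xs (λ _ → 0ℤ) ≡ 0ℤ
∑∈-0 []       = refl
∑∈-0 (x ∷ xs) = trans (ℤ.+-identityˡ _) (∑∈-0 xs)

∑∈-swap : ∀ {A B : Set} (xs : List A) (ys : List B) (f : A → B → ℤ) →
  ∑∈ xs (λ x → ∑∈ ys (f x)) ≡ ∑∈ ys (λ y → ∑∈ xs (λ x → f x y))
∑∈-swap []       ys f = sym (∑∈-0 ys)
∑∈-swap (x ∷ xs) ys f =
  trans (cong (ℤ._+_ (∑∈ ys (f x))) (∑∈-swap xs ys f)) (sym (∑∈-+ ys (f x) _))

∑∈-++ : ∀ {A : Set} (xs ys : List A) f → ∑∈ (xs ++ ys) f ≡ ∑∈ xs f ℤ.+ ∑∈ ys f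
∑∈-++ []       ys f = sym (ℤ.+-identityˡ _)
∑∈-++ (x ∷ xs) ys f = trans (cong (ℤ._+_ (f x)) (∑∈-++ xs ys f)) (sym (ℤ.+-assoc (f x) _ _))

∑∈-map : ∀ {A B : Set} (g : A → B) xs f → ∑∈ (List.map g xs) f ≡ ∑∈ xs (f ∘ g)
∑∈-map g []       f = refl
∑∈-map g (x ∷ xs) f = cong (ℤ._+_ (f (g x))) (∑∈-map g xs f)

∑∈-product : ∀ {A B C : Set} (g : A → B → C) xs ys f →
  ∑∈ (cartesianProductWith g xs ys) f ≡ ∑∈ xs (λ x → ∑∈ ys (f ∘ g x))
∑∈-product g []       ys f = refl
∑∈-product g (x ∷ xs) ys f = trans (∑∈-++ (List.map (g x) ys) _ f)
  (cong₂ ℤ._+_ (∑∈-map (g x) ys f) (∑∈-product g xs ys f))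

∑-cong : ∀ {f g : ℕ → ℤ} n → (∀ k → k < n → f k ≡ g k) → ∑ n f ≡ ∑ n g
∑-cong zero    eq = refl
∑-cong (suc n) eq = cong₂ ℤ._+_ (eq n ℕ.≤-refl) (∑-cong n (λ k k<n → eq k (ℕ.m<n⇒m<1+n k<n)))

∏-cong : ∀ {f g : ℕ → ℤ} n → (∀ k → k < n → f k ≡ g k) → ∏ n f ≡ ∏ n g
∏-cong zero    eq = refl
∏-cong (suc n) eq = cong₂ ℤ._*_ (eq n ℕ.≤-refl) (∏-cong n (λ k k<n → eq k (ℕ.m<n⇒m<1+n k<n)))

∏-* : ∀ n f g → ∏ n (λ k → f k ℤ.* g k) ≡ ∏ n f ℤ.* ∏ n g
∏-* zero    f g = refl
∏-* (suc n) f g =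
  trans (cong (ℤ._*_ (f n ℤ.* g n)) (∏-* n f g)) (*-interchange (f n) (g n) (∏ n f) (∏ n g))

∏-head : ∀ n f → ∏ (suc n) f ≡ f 0 ℤ.* ∏ n (f ∘ suc)
∏-head zero    f = refl
∏-head (suc n) f = trans (cong (ℤ._*_ (f (suc n))) (∏-head n f)) (*-swap (f (suc n)) (f 0) (∏ n (f ∘ suc)))

∑-blocks : ∀ N L f → ∑ (L * N) f ≡ ∑ L (λ q → ∑ N (λ k → f (k + q * N)))
∑-blocks N zero    f = refl
∑-blocks N (suc q) f = trans (∑-split N) (cong (ℤ._+_ (∑ N (λ k → f (k + q * N)))) (∑-blocks N q f))
  where
  ∑-split : ∀ k → ∑ (k + q * N) f ≡ ∑ k (λ k → f (k + q * N)) ℤ.+ ∑ (q * N) f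
  ∑-split zero    = sym (ℤ.+-identityˡ _)
  ∑-split (suc k) = trans (cong (ℤ._+_ (f (k + q * N))) (∑-split k)) (sym (ℤ.+-assoc (f (k + q * N)) _ _))

*-^-distrib : ∀ i j n → (i ℤ.* j) ℤ.^ n ≡ i ℤ.^ n ℤ.* j ℤ.^ n
*-^-distrib i j zero    = refl
*-^-distrib i j (suc n) =
  trans (cong (ℤ._*_ (i ℤ.* j)) (*-^-distrib i j n)) (*-interchange i j (i ℤ.^ n) (j ℤ.^ n))

-- Base-N digits, the least significant one having the largest index.

module Digits (N : ℕ) .{{_ : NonZero N}} where

  ∏digits : ℕ → (ℕ → ℕ → ℤ) → ℕ → ℤ
  ∏digits zero    φ K = 1ℤ
  ∏digits (suc n) φ K = φ n (K ℕ.% N) ℤ.* ∏digits n φ (K ℕ./ N)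

  ∏digits-cong : ∀ n {φ ψ : ℕ → ℕ → ℤ} → (∀ i k → φ i k ≡ ψ i k) → ∀ K → ∏digits n φ K ≡ ∏digits n ψ K
  ∏digits-cong zero    eq K = refl
  ∏digits-cong (suc n) eq K = cong₂ ℤ._*_ (eq n (K ℕ.% N)) (∏digits-cong n eq (K ℕ./ N))

  ∏digits-* : ∀ n φ ψ K → ∏digits n (λ i k → φ i k ℤ.* ψ i k) K ≡ ∏digits n φ K ℤ.* ∏digits n ψ K
  ∏digits-* zero    φ ψ K = refl
  ∏digits-* (suc n) φ ψ K = trans (cong (ℤ._*_ (φ n (K ℕ.% N) ℤ.* ψ n (K ℕ.% N))) (∏digits-* n φ ψ (K ℕ./ N)))
    (*-interchange (φ n (K ℕ.% N)) (ψ n (K ℕ.% N)) (∏digits n φ (K ℕ./ N)) (∏digits n ψ (K ℕ./ N)))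

  ∏digits-1 : ∀ n K → ∏digits n (λ _ _ → 1ℤ) K ≡ 1ℤ
  ∏digits-1 zero    K = refl
  ∏digits-1 (suc n) K = trans (ℤ.*-identityˡ _) (∏digits-1 n (K ℕ./ N))

  ∏digits-^ : ∀ n φ K x → ∏digits n (λ i k → φ i k ℤ.^ x) K ≡ ∏digits n φ K ℤ.^ x
  ∏digits-^ n φ K zero    = ∏digits-1 n K
  ∏digits-^ n φ K (suc x) =
    trans (∏digits-* n φ (λ i k → φ i k ℤ.^ x) K) (cong (ℤ._*_ (∏digits n φ K)) (∏digits-^ n φ K x))

  -- The distributive law, with the choices of one term per factor numbered by K: the digits of K <
  -- N ^ n run through all tuples exactly once. Splitting off the lowest digit gives the induction.
  ∑-∏digits : ∀ n φ → ∑ (N ^ n) (∏digits n φ) ≡ ∏ n (λ i → ∑ N (φ i))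
  ∑-∏digits zero    φ = refl
  ∑-∏digits (suc n) φ = begin
    ∑ (N * N ^ n) (∏digits (suc n) φ)
      ≡⟨ cong (λ L → ∑ L (∏digits (suc n) φ)) (ℕ.*-comm N (N ^ n)) ⟩
    ∑ (N ^ n * N) (∏digits (suc n) φ)
      ≡⟨ ∑-blocks N (N ^ n) (∏digits (suc n) φ) ⟩
    ∑ (N ^ n) (λ q → ∑ N (λ k → ∏digits (suc n) φ (k + q * N)))
      ≡⟨ ∑-cong (N ^ n) (λ q _ → block q) ⟩
    ∑ (N ^ n) (λ q → ∑ N (φ n) ℤ.* ∏digits n φ q)
      ≡⟨ ∑∈-distribˡ (∑ N (φ n)) (downFrom (N ^ n)) (∏digits n φ) ⟩
    ∑ N (φ n) ℤ.* ∑ (N ^ n) (∏digits n φ)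
      ≡⟨ cong (ℤ._*_ (∑ N (φ n))) (∑-∏digits n φ) ⟩
    ∑ N (φ n) ℤ.* ∏ n (λ i → ∑ N (φ i)) ∎
    where
    open ≡-Reasoning
    block : ∀ q → ∑ N (λ k → ∏digits (suc n) φ (k + q * N)) ≡ ∑ N (φ n) ℤ.* ∏digits n φ q
    block q = begin
      ∑ N (λ k → ∏digits (suc n) φ (k + q * N))
        ≡⟨ ∑-cong N (λ k k<N → trans
             (cong₂ (λ r s → φ n r ℤ.* ∏digits n φ s)
               (trans (ℕ.[m+kn]%n≡m%n k q N) (ℕ.m<n⇒m%n≡m k<N))
               (trans (ℕ.+-distrib-/-∣ʳ k (ℕ.n∣m*n q))
                 (cong₂ _+_ (ℕ.m<n⇒m/n≡0 k<N) (ℕ.m*n/n≡m q N))))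
             (ℤ.*-comm (φ n k) (∏digits n φ q))) ⟩
      ∑ N (λ k → ∏digits n φ q ℤ.* φ n k)
        ≡⟨ ∑∈-distribˡ (∏digits n φ q) (downFrom N) (φ n) ⟩
      ∏digits n φ q ℤ.* ∑ N (φ n)
        ≡⟨ ℤ.*-comm (∏digits n φ q) (∑ N (φ n)) ⟩
      ∑ N (φ n) ℤ.* ∏digits n φ q ∎

-- Finite differences

-- (-1)ᵏ (y choose k)
β : ℕ → ℕ → ℤ
β y       zero    = 1ℤ
β zero    (suc k) = 0ℤ
β (suc y) (suc k) = β y (suc k) ℤ.- β y k

β-0 : ∀ y → β y 0 ≡ 1ℤ
β-0 zero    = refl
β-0 (suc y) = refl

-- (1 - E)^y applied to f and evaluated at 0, where E is the shift. It equals (-1)^y times the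
-- forward difference of order y.
∇ : ℕ → (ℕ → ℤ) → ℤ
∇ zero    f = f 0
∇ (suc y) f = ∇ y f ℤ.- ∇ y (f ∘ suc)

-- Pascal's rule for β is the recursion of ∇. As β vanishes beyond y, every N > y gives the same
-- sum, so one range of nodes serves all rows.
∑-β : ∀ y N f → y < N → ∑ N (λ k → β y k ℤ.* f k) ≡ ∇ y f
∑-β zero    (suc N) f _ = only N
  where
  only : ∀ N → ∑ (suc N) (λ k → β 0 k ℤ.* f k) ≡ f 0
  only zero    = trans (ℤ.+-identityʳ _) (ℤ.*-identityˡ _)
  only (suc N) = trans (cong (ℤ._+ ∑ (suc N) (λ k → β 0 k ℤ.* f k)) (ℤ.*-zeroˡ (f (suc N)))) (trans (ℤ.+-identityˡ _) (only N))
∑-β (suc y) (suc N) f (s≤s y<N) = trans (pascal N) (cong₂ ℤ._-_ (∑-β y (suc N) f (ℕ.m<n⇒m<1+n y<N)) (∑-β y N (f ∘ suc) y<N))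
  where
  step : ∀ a b f s t → (a ℤ.- b) ℤ.* f ℤ.+ (s ℤ.- t) ≡ (a ℤ.* f ℤ.+ s) ℤ.- (b ℤ.* f ℤ.+ t)
  step = solve-∀
  base : ∀ a → a ≡ a ℤ.- 0ℤ
  base = solve-∀
  -- The part coming from β y (k - 1) has no term for k = 0; after reindexing it is one term
  -- shorter.
  pascal : ∀ N → ∑ (suc N) (λ k → β (suc y) k ℤ.* f k) ≡
    ∑ (suc N) (λ k → β y k ℤ.* f k) ℤ.- ∑ N (λ k → β y k ℤ.* f (suc k))
  pascal zero rewrite β-0 y = base _
  pascal (suc N) = trans (cong (ℤ._+_ (β (suc y) (suc N) ℤ.* f (suc N))) (pascal N))
    (step (β y (suc N)) (β y N) (f (suc N)) _ _)

shift-node : ∀ a k → a ℤ.- (1ℤ ℤ.+ k) ≡ (a ℤ.- 1ℤ) ℤ.- k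
shift-node = solve-∀

∇-cong : ∀ y {f g : ℕ → ℤ} → (∀ k → f k ≡ g k) → ∇ y f ≡ ∇ y g
∇-cong zero    eq = eq 0
∇-cong (suc y) eq = cong₂ ℤ._-_ (∇-cong y eq) (∇-cong y (eq ∘ suc))

-- The Leibniz rule for (1 - E)^(y + 1) and a linear factor. The centre a is arbitrary because a
-- shift of the argument turns a into a - 1, and the inductions need that.
∇-linear : ∀ y a f → ∇ (suc y) (λ k → (a ℤ.- + k) ℤ.* f k) ≡
  a ℤ.* ∇ (suc y) f ℤ.+ + suc y ℤ.* ∇ y (f ∘ suc)
∇-linear zero    a f = eq a (f 0) (f 1)
  where
  eq : ∀ a b c → (a ℤ.- + 0) ℤ.* b ℤ.- (a ℤ.- + 1) ℤ.* c ≡ a ℤ.* (b ℤ.- c) ℤ.+ + 1 ℤ.* c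
  eq = solve-∀
∇-linear (suc y) a f = begin
  ∇ (suc y) (λ k → (a ℤ.- + k) ℤ.* f k) ℤ.- ∇ (suc y) (λ k → (a ℤ.- + suc k) ℤ.* f (suc k))
    ≡⟨ cong₂ ℤ._-_ (∇-linear y a f)
         (trans (∇-cong (suc y) (λ k → cong (ℤ._* f (suc k)) (shift-node a (+ k)))) (∇-linear y (a ℤ.- 1ℤ) (f ∘ suc))) ⟩
  (a ℤ.* ∇ (suc y) f ℤ.+ + suc y ℤ.* ∇ y (f ∘ suc)) ℤ.-
  ((a ℤ.- 1ℤ) ℤ.* ∇ (suc y) (f ∘ suc) ℤ.+ + suc y ℤ.* ∇ y (f ∘ suc ∘ suc))
    ≡⟨ collect a (∇ (suc y) f) (∇ y (f ∘ suc)) (∇ y (f ∘ suc ∘ suc)) (+ suc y) ⟩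
  a ℤ.* (∇ (suc y) f ℤ.- ∇ (suc y) (f ∘ suc)) ℤ.+ (1ℤ ℤ.+ + suc y) ℤ.* ∇ (suc y) (f ∘ suc) ∎
  where
  open ≡-Reasoning
  collect : ∀ a u v w s → (a ℤ.* u ℤ.+ s ℤ.* v) ℤ.- ((a ℤ.- 1ℤ) ℤ.* (v ℤ.- w) ℤ.+ s ℤ.* w) ≡
    a ℤ.* (u ℤ.- (v ℤ.- w)) ℤ.+ (1ℤ ℤ.+ s) ℤ.* (v ℤ.- w)
  collect = solve-∀

-- Each difference lowers the degree by one; `∇-linear` peels one factor off the power and one order
-- off the difference.
∇-power-< : ∀ y e a → e < y → ∇ y (λ k → (a ℤ.- + k) ℤ.^ e) ≡ 0ℤ
∇-power-< (suc y) zero    a _ = const y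
  where
  const : ∀ y → ∇ (suc y) (λ _ → 1ℤ) ≡ 0ℤ
  const y = ℤ.i≡j⇒i-j≡0 {∇ y (λ _ → 1ℤ)} refl
∇-power-< (suc y) (suc e) a (s≤s e<y) = begin
  ∇ (suc y) (λ k → (a ℤ.- + k) ℤ.^ suc e)
    ≡⟨ ∇-linear y a (λ k → (a ℤ.- + k) ℤ.^ e) ⟩
  a ℤ.* ∇ (suc y) (λ k → (a ℤ.- + k) ℤ.^ e) ℤ.+ + suc y ℤ.* ∇ y (λ k → (a ℤ.- + suc k) ℤ.^ e)
    ≡⟨ cong₂ (λ u v → a ℤ.* u ℤ.+ + suc y ℤ.* v) (∇-power-< (suc y) e a (ℕ.m<n⇒m<1+n e<y))
         (trans (∇-cong y (λ k → cong (ℤ._^ e) (shift-node a (+ k)))) (∇-power-< y e (a ℤ.- 1ℤ) e<y)) ⟩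
  a ℤ.* 0ℤ ℤ.+ + suc y ℤ.* 0ℤ
    ≡⟨ zeros a (+ suc y) ⟩
  0ℤ ∎
  where
  open ≡-Reasoning
  zeros : ∀ a b → a ℤ.* 0ℤ ℤ.+ b ℤ.* 0ℤ ≡ 0ℤ
  zeros = solve-∀

-- The leading coefficient (-1)^y of (a - k)^y cancels the sign by which ∇ differs from the forward
-- difference.
∇-power-≡ : ∀ y a → ∇ y (λ k → (a ℤ.- + k) ℤ.^ y) ≡ + (y !)
∇-power-≡ zero    a = refl
∇-power-≡ (suc y) a = begin
  ∇ (suc y) (λ k → (a ℤ.- + k) ℤ.^ suc y)
    ≡⟨ ∇-linear y a (λ k → (a ℤ.- + k) ℤ.^ y) ⟩
  a ℤ.* ∇ (suc y) (λ k → (a ℤ.- + k) ℤ.^ y) ℤ.+ + suc y ℤ.* ∇ y (λ k → (a ℤ.- + suc k) ℤ.^ y)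
    ≡⟨ cong₂ (λ u v → a ℤ.* u ℤ.+ + suc y ℤ.* v) (∇-power-< (suc y) y a ℕ.≤-refl)
         (trans (∇-cong y (λ k → cong (ℤ._^ y) (shift-node a (+ k)))) (∇-power-≡ y (a ℤ.- 1ℤ))) ⟩
  a ℤ.* 0ℤ ℤ.+ + suc y ℤ.* + (y !)
    ≡⟨ trans (cong (ℤ._+ + suc y ℤ.* + (y !)) (ℤ.*-zeroʳ a)) (ℤ.+-identityˡ _) ⟩
  + suc y ℤ.* + (y !)
    ≡⟨ ℤ.pos-* (suc y) (y !) ⟨
  + (suc y * y !) ∎
  where
  open ≡-Reasoning

β-step : ∀ y k → + suc k ℤ.* β y (suc k) ≡ (+ k ℤ.- + y) ℤ.* β y k
β-step zero    zero    = refl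
β-step zero    (suc k) = trans (ℤ.*-zeroʳ (+ suc (suc k))) (sym (ℤ.*-zeroʳ (+ suc k ℤ.- + 0)))
β-step (suc y) zero    = begin
  1ℤ ℤ.* (β y 1 ℤ.- β y 0)      ≡⟨ eq₁ (β y 1) (β y 0) ⟩
  1ℤ ℤ.* β y 1 ℤ.- β y 0        ≡⟨ cong₂ ℤ._-_ (β-step y 0) (β-0 y) ⟩
  (+ 0 ℤ.- + y) ℤ.* β y 0 ℤ.- 1ℤ ≡⟨ cong (λ b → (+ 0 ℤ.- + y) ℤ.* b ℤ.- 1ℤ) (β-0 y) ⟩
  (+ 0 ℤ.- + y) ℤ.* 1ℤ ℤ.- 1ℤ   ≡⟨ eq₂ (+ y) ⟩
  (+ 0 ℤ.- + suc y) ℤ.* 1ℤ      ∎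
  where
  open ≡-Reasoning
  eq₁ : ∀ a b → 1ℤ ℤ.* (a ℤ.- b) ≡ 1ℤ ℤ.* a ℤ.- b
  eq₁ = solve-∀
  eq₂ : ∀ y → (0ℤ ℤ.- y) ℤ.* 1ℤ ℤ.- 1ℤ ≡ (0ℤ ℤ.- (1ℤ ℤ.+ y)) ℤ.* 1ℤ
  eq₂ = solve-∀
β-step (suc y) (suc k) = begin
  (1ℤ ℤ.+ + suc k) ℤ.* (β y (suc (suc k)) ℤ.- β y (suc k))
    ≡⟨ eq₁ (+ suc k) (β y (suc (suc k))) (β y (suc k)) ⟩
  (1ℤ ℤ.+ + suc k) ℤ.* β y (suc (suc k)) ℤ.- (+ suc k ℤ.* β y (suc k) ℤ.+ β y (suc k))
    ≡⟨ cong₂ (λ u v → u ℤ.- (v ℤ.+ β y (suc k))) (β-step y (suc k)) (β-step y k) ⟩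
  (+ suc k ℤ.- + y) ℤ.* β y (suc k) ℤ.- ((+ k ℤ.- + y) ℤ.* β y k ℤ.+ β y (suc k))
    ≡⟨ eq₂ (+ k) (+ y) (β y (suc k)) (β y k) ⟩
  (+ suc k ℤ.- + suc y) ℤ.* (β y (suc k) ℤ.- β y k) ∎
  where
  open ≡-Reasoning
  eq₁ : ∀ s a b → (1ℤ ℤ.+ s) ℤ.* (a ℤ.- b) ≡ (1ℤ ℤ.+ s) ℤ.* a ℤ.- (s ℤ.* b ℤ.+ b)
  eq₁ = solve-∀
  eq₂ : ∀ k y a b → ((1ℤ ℤ.+ k) ℤ.- y) ℤ.* a ℤ.- ((k ℤ.- y) ℤ.* b ℤ.+ a) ≡
    ((1ℤ ℤ.+ k) ℤ.- (1ℤ ℤ.+ y)) ℤ.* (a ℤ.- b)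
  eq₂ = solve-∀

-- This makes the weights computable by plain loops: a numerator and a denominator are accumulated
-- as products, and one exact division follows.
β-exact : ∀ y k → ∏ k (λ t → + t ℤ.- + y) ≡ + (k !) ℤ.* β y k
β-exact zero    zero    = refl
β-exact (suc y) zero    = refl
β-exact y       (suc k) = begin
  (+ k ℤ.- + y) ℤ.* ∏ k (λ t → + t ℤ.- + y)  ≡⟨ cong (ℤ._*_ (+ k ℤ.- + y)) (β-exact y k) ⟩
  (+ k ℤ.- + y) ℤ.* (+ (k !) ℤ.* β y k)       ≡⟨ *-swap (+ k ℤ.- + y) (+ (k !)) (β y k) ⟩
  + (k !) ℤ.* ((+ k ℤ.- + y) ℤ.* β y k)       ≡⟨ cong (ℤ._*_ (+ (k !))) (β-step y k) ⟨
  + (k !) ℤ.* (+ suc k ℤ.* β y (suc k))       ≡⟨ assoc (+ (k !)) (+ suc k) (β y (suc k)) ⟩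
  + suc k ℤ.* + (k !) ℤ.* β y (suc k)         ≡⟨ cong (ℤ._* β y (suc k)) (ℤ.pos-* (suc k) (k !)) ⟨
  + (suc k * k !) ℤ.* β y (suc k)             ∎
  where
  open ≡-Reasoning
  assoc : ∀ a b c → a ℤ.* (b ℤ.* c) ≡ b ℤ.* a ℤ.* c
  assoc = solve-∀

-- Extraction of a leading coefficient

𝟙 : ∀ {A : Set} → Dec A → ℤ
𝟙 (true  because _) = 1ℤ
𝟙 (false because _) = 0ℤ

𝟙-yes : ∀ {A : Set} (d : Dec A) → A → 𝟙 d ≡ 1ℤ
𝟙-yes (yes _) a = refl
𝟙-yes (no ¬a) a = contradiction a ¬a

𝟙-no : ∀ {A : Set} (d : Dec A) → ¬ A → 𝟙 d ≡ 0ℤ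
𝟙-no (yes a) ¬a = contradiction a ¬a
𝟙-no (no _)  ¬a = refl

∏-𝟙 : ∀ n {P : ℕ → Set} (P? : ∀ k → Dec (P k)) (all? : Dec (∀ {k} → k < n → P k)) →
  ∏ n (λ k → 𝟙 (P? k)) ≡ 𝟙 all?
∏-𝟙 zero    P? all? = sym (𝟙-yes all? (λ ()))
∏-𝟙 (suc n) P? all? with P? n
... | no ¬p = trans (ℤ.*-zeroˡ (∏ n (λ k → 𝟙 (P? k)))) (sym (𝟙-no all? (λ p → ¬p (p ℕ.≤-refl))))
... | yes p with ∏-𝟙 n P? (ℕ.allUpTo? P? n)
...   | eq with ℕ.allUpTo? P? n
...     | no ¬q = trans (ℤ.*-identityˡ _) (trans eq (sym (𝟙-no all? (λ q → ¬q (λ k<n → q (ℕ.m<n⇒m<1+n k<n))))))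
...     | yes q = trans (ℤ.*-identityˡ _) (trans eq (sym (𝟙-yes all? below)))
  where
  below : ∀ {k} → k < suc n → _
  below {k} k<1+n with ℕ.m≤n⇒m<n∨m≡n (ℕ.≤-pred k<1+n)
  ... | inj₁ k<n  = q k<n
  ... | inj₂ refl = p

∑∈-𝟙 : ∀ {A : Set} {P : A → Set} (P? : ∀ x → Dec (P x)) xs → ∑∈ xs (𝟙 ∘ P?) ≡ + length (filter P? xs)
∑∈-𝟙 P? []       = refl
∑∈-𝟙 P? (x ∷ xs) with P? x
... | true because _ = cong (ℤ._+_ 1ℤ) (∑∈-𝟙 P? xs)
... | false because _ = trans (ℤ.+-identityˡ _) (∑∈-𝟙 P? xs)

-- The congruence t / P ≡ d modulo X without a division. It is stable under sums with a common P and
-- under products, which multiply the P's; these are the two ways in which T is assembled.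
record Leading (X P d t : ℤ) : Set where
  constructor _,_
  field
    remainder : ℤ
    expansion : t ≡ P ℤ.* (d ℤ.+ X ℤ.* remainder)

Leading-∑∈ : ∀ {A : Set} {X P} (xs : List A) {d t : A → ℤ} → (∀ x → Leading X P (d x) (t x)) →
  Leading X P (∑∈ xs d) (∑∈ xs t)
Leading-∑∈ {X = X} {P} []       l = 0ℤ , eq X P
  where
  eq : ∀ X P → 0ℤ ≡ P ℤ.* (0ℤ ℤ.+ X ℤ.* 0ℤ)
  eq = solve-∀
Leading-∑∈ {X = X} {P} (x ∷ xs) {d} l with l x | Leading-∑∈ xs l
... | U , p | V , q = U ℤ.+ V , trans (cong₂ ℤ._+_ p q) (eq X P (d x) U (∑∈ xs d) V)
  where
  eq : ∀ X P a U b V → P ℤ.* (a ℤ.+ X ℤ.* U) ℤ.+ P ℤ.* (b ℤ.+ X ℤ.* V) ≡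
    P ℤ.* ((a ℤ.+ b) ℤ.+ X ℤ.* (U ℤ.+ V))
  eq = solve-∀

Leading-∏ : ∀ {X} n {P d t : ℕ → ℤ} → (∀ k → k < n → Leading X (P k) (d k) (t k)) →
  Leading X (∏ n P) (∏ n d) (∏ n t)
Leading-∏ {X} zero    l = 0ℤ , eq X
  where
  eq : ∀ X → 1ℤ ≡ 1ℤ ℤ.* (1ℤ ℤ.+ X ℤ.* 0ℤ)
  eq = solve-∀
Leading-∏ {X} (suc n) {P} {d} l with l n ℕ.≤-refl | Leading-∏ n (λ k k<n → l k (ℕ.m<n⇒m<1+n k<n))
... | U , p | V , q = d n ℤ.* V ℤ.+ U ℤ.* (∏ n d ℤ.+ X ℤ.* V) ,
    trans (cong₂ ℤ._*_ p q) (eq X (P n) (d n) U (∏ n P) (∏ n d) V)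
  where
  eq : ∀ X P a U Q b V → (P ℤ.* (a ℤ.+ X ℤ.* U)) ℤ.* (Q ℤ.* (b ℤ.+ X ℤ.* V)) ≡
    (P ℤ.* Q) ℤ.* (a ℤ.* b ℤ.+ X ℤ.* (a ℤ.* V ℤ.+ U ℤ.* (b ℤ.+ X ℤ.* V)))
  eq = solve-∀

dot : ∀ {m} → (ℕ → ℕ) → Vec ℕ m → ℕ
dot a []      = 0
dot a (x ∷ v) = a 0 * x + dot (a ∘ suc) v

monomial : ∀ {m} → (ℕ → ℤ) → Vec ℕ m → ℤ
monomial w []      = 1ℤ
monomial w (x ∷ v) = w 0 ℤ.^ x ℤ.* monomial (w ∘ suc) v

box : ℕ → ∀ m → List (Vec ℕ m)
box N zero    = [] ∷ []
box N (suc m) = cartesianProductWith _∷_ (downFrom N) (box N m)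

∏-∑-monomial : ∀ N m w → ∏ m (λ j → ∑ N (ℤ._^_ (w j))) ≡ ∑∈ (box N m) (monomial w)
∏-∑-monomial N zero    w = refl
∏-∑-monomial N (suc m) w = begin
  ∏ (suc m) (λ j → ∑ N (ℤ._^_ (w j)))
    ≡⟨ ∏-head m (λ j → ∑ N (ℤ._^_ (w j))) ⟩
  ∑ N (ℤ._^_ (w 0)) ℤ.* ∏ m (λ j → ∑ N (ℤ._^_ (w (suc j))))
    ≡⟨ cong (ℤ._*_ (∑ N (ℤ._^_ (w 0)))) (∏-∑-monomial N m (w ∘ suc)) ⟩
  ∑ N (ℤ._^_ (w 0)) ℤ.* S
    ≡⟨ ℤ.*-comm (∑ N (ℤ._^_ (w 0))) S ⟩
  S ℤ.* ∑ N (ℤ._^_ (w 0))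
    ≡⟨ ∑∈-distribˡ S (downFrom N) (ℤ._^_ (w 0)) ⟨
  ∑ N (λ x → S ℤ.* w 0 ℤ.^ x)
    ≡⟨ ∑∈-cong (downFrom N) (λ x → trans (ℤ.*-comm S (w 0 ℤ.^ x))
         (sym (∑∈-distribˡ (w 0 ℤ.^ x) (box N m) (monomial (w ∘ suc))))) ⟩
  ∑ N (λ x → ∑∈ (box N m) (λ v → w 0 ℤ.^ x ℤ.* monomial (w ∘ suc) v))
    ≡⟨ ∑∈-product _∷_ (downFrom N) (box N m) (monomial w) ⟨
  ∑∈ (box N (suc m)) (monomial w) ∎
  where
  open ≡-Reasoning
  S = ∑∈ (box N m) (monomial (w ∘ suc))

module Counting (n m M : ℕ) (al : ℕ → ℕ → ℕ) (ys : ℕ → ℕ) (ys≤M : ∀ i → i < n → ys i ≤ M) where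

  open Digits (suc M)

  Solution : Vec ℕ m → Set
  Solution v = ∀ {i} → i < n → dot (al i) v ≡ ys i

  solution? : ∀ v → Dec (Solution v)
  solution? v = ℕ.allUpTo? (λ i → dot (al i) v ℕ.≟ ys i) n

  solutions : List (Vec ℕ m)
  solutions = filter solution? (box (suc M) m)

  -- The negative sign makes the leading coefficient y! rather than (-1)^y y!, so the divisor D is
  -- positive.
  node : ℤ → ℕ → ℤ
  node X k = (0ℤ ℤ.- + k) ℤ.* X

  weight : ℕ → ℤ
  weight = ∏digits n (λ i → β (ys i))

  power : ℤ → ℕ → ℕ → ℤ
  power X K j = ∏digits n (λ i k → node X k ℤ.^ al i j) K

  summand : ℤ → ℕ → ℤ
  summand X K = weight K ℤ.* ∏ m (λ j → ∑ (suc M) (ℤ._^_ (power X K j)))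

  -- Exchanging the products over columns and rows collects the exponent of node i into row i of A
  -- times v: ∏ⱼ (∏ᵢ zᵢ^aᵢⱼ)^vⱼ = ∏ᵢ zᵢ^(Av)ᵢ.
  monomial-digits : ∀ X K {m} (v : Vec ℕ m) (a : ℕ → ℕ → ℕ) →
    monomial (λ j → ∏digits n (λ i k → node X k ℤ.^ a i j) K) v ≡
    ∏digits n (λ i k → node X k ℤ.^ dot (a i) v) K
  monomial-digits X K []      a = sym (∏digits-1 n K)
  monomial-digits X K (x ∷ v) a = begin
    ∏digits n (λ i k → node X k ℤ.^ a i 0) K ℤ.^ x ℤ.*
    monomial (λ j → ∏digits n (λ i k → node X k ℤ.^ a i (suc j)) K) v
      ≡⟨ cong₂ ℤ._*_ (sym (∏digits-^ n _ K x)) (monomial-digits X K v (λ i → a i ∘ suc)) ⟩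
    ∏digits n (λ i k → (node X k ℤ.^ a i 0) ℤ.^ x) K ℤ.*
    ∏digits n (λ i k → node X k ℤ.^ dot (a i ∘ suc) v) K
      ≡⟨ ∏digits-* n _ _ K ⟨
    ∏digits n (λ i k → (node X k ℤ.^ a i 0) ℤ.^ x ℤ.* node X k ℤ.^ dot (a i ∘ suc) v) K
      ≡⟨ ∏digits-cong n (λ i k → trans
           (cong (ℤ._* (node X k ℤ.^ dot (a i ∘ suc) v)) (ℤ.^-*-assoc (node X k) (a i 0) x))
           (sym (ℤ.^-distribˡ-+-* (node X k) (a i 0 * x) _))) K ⟩
    ∏digits n (λ i k → node X k ℤ.^ dot (a i) (x ∷ v)) K ∎
    where open ≡-Reasoning

  -- By homogeneity X^e comes out of the sum, and a difference of order yᵢ of an e-th power remains.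
  -- It is known for e ≤ yᵢ; for e > yᵢ its value does not matter.
  leading-factor : ∀ X i → i < n → ∀ e →
    Leading X (X ℤ.^ ys i) (+ (ys i !) ℤ.* 𝟙 (e ℕ.≟ ys i)) (∑ (suc M) (λ k → β (ys i) k ℤ.* node X k ℤ.^ e))
  leading-factor X i i<n e with ℕ.<-cmp e (ys i) | difference
    where
    y = ys i
    open ≡-Reasoning
    swap : ∀ a b c → a ℤ.* (b ℤ.* c) ≡ c ℤ.* (a ℤ.* b)
    swap = solve-∀
    difference : ∑ (suc M) (λ k → β y k ℤ.* node X k ℤ.^ e) ≡ X ℤ.^ e ℤ.* ∇ y (λ k → (0ℤ ℤ.- + k) ℤ.^ e)
    difference = begin
      ∑ (suc M) (λ k → β y k ℤ.* node X k ℤ.^ e)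
        ≡⟨ ∑∈-cong (downFrom (suc M)) (λ k → trans
             (cong (ℤ._*_ (β y k)) (*-^-distrib (0ℤ ℤ.- + k) X e))
             (swap (β y k) ((0ℤ ℤ.- + k) ℤ.^ e) (X ℤ.^ e))) ⟩
      ∑ (suc M) (λ k → X ℤ.^ e ℤ.* (β y k ℤ.* (0ℤ ℤ.- + k) ℤ.^ e))
        ≡⟨ ∑∈-distribˡ (X ℤ.^ e) (downFrom (suc M)) _ ⟩
      X ℤ.^ e ℤ.* ∑ (suc M) (λ k → β y k ℤ.* (0ℤ ℤ.- + k) ℤ.^ e)
        ≡⟨ cong (ℤ._*_ (X ℤ.^ e)) (∑-β y (suc M) _ (s≤s (ys≤M i i<n))) ⟩
      X ℤ.^ e ℤ.* ∇ y (λ k → (0ℤ ℤ.- + k) ℤ.^ e) ∎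
  ... | tri≈ _ refl _ | difference = 0ℤ ,
      trans difference (trans (cong (ℤ._*_ (X ℤ.^ e)) (∇-power-≡ e 0ℤ))
        (trans (eq (X ℤ.^ e) (+ (e !)) X)
          (cong (λ o → X ℤ.^ e ℤ.* (+ (e !) ℤ.* o ℤ.+ X ℤ.* 0ℤ)) (sym (𝟙-yes (e ℕ.≟ e) refl)))))
    where
    eq : ∀ P d X → P ℤ.* d ≡ P ℤ.* (d ℤ.* 1ℤ ℤ.+ X ℤ.* 0ℤ)
    eq = solve-∀
  ... | tri< e<y e≢y _ | difference = 0ℤ ,
      trans difference (trans (cong (ℤ._*_ (X ℤ.^ e)) (∇-power-< (ys i) e 0ℤ e<y))
        (trans (eq (X ℤ.^ e) (X ℤ.^ ys i) (+ (ys i !)) X)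
          (cong (λ o → X ℤ.^ ys i ℤ.* (+ (ys i !) ℤ.* o ℤ.+ X ℤ.* 0ℤ)) (sym (𝟙-no (e ℕ.≟ ys i) e≢y)))))
    where
    eq : ∀ Q P d X → Q ℤ.* 0ℤ ≡ P ℤ.* (d ℤ.* 0ℤ ℤ.+ X ℤ.* 0ℤ)
    eq = solve-∀
  -- Of X^e, the part X^yᵢ is the common scale, one further X makes the term vanish modulo X, and
  -- the remaining power goes into the witness.
  ... | tri> _ e≢y y<e | difference = X ℤ.^ (e ∸ suc (ys i)) ℤ.* δ ,
      trans difference (trans (cong (ℤ._* δ)
          (trans (cong (ℤ._^_ X) (sym (trans (ℕ.+-suc (ys i) (e ∸ suc (ys i))) (ℕ.m+[n∸m]≡n y<e))))
            (ℤ.^-distribˡ-+-* X (ys i) (suc (e ∸ suc (ys i))))))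
        (trans (eq (X ℤ.^ ys i) (X ℤ.^ (e ∸ suc (ys i))) (+ (ys i !)) X δ)
          (cong (λ o → X ℤ.^ ys i ℤ.* (+ (ys i !) ℤ.* o ℤ.+ X ℤ.* (X ℤ.^ (e ∸ suc (ys i)) ℤ.* δ)))
            (sym (𝟙-no (e ℕ.≟ ys i) e≢y)))))
    where
    δ = ∇ (ys i) (λ k → (0ℤ ℤ.- + k) ℤ.^ e)
    eq : ∀ P Q d X δ → P ℤ.* (X ℤ.* Q) ℤ.* δ ≡ P ℤ.* (d ℤ.* 0ℤ ℤ.+ X ℤ.* (Q ℤ.* δ))
    eq = solve-∀

  -- Once the geometric sums are expanded, each vector v of the box contributes a sum over K that
  -- factors over the rows. Modulo X its factor i is yᵢ! or 0, according to whether row i of the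
  -- system holds, so the solutions contribute D each.
  leading-count : ∀ X → Leading X (∏ n (λ i → X ℤ.^ ys i))
    (∏ n (λ i → + (ys i !)) ℤ.* + length solutions) (∑ (suc M ^ n) (summand X))
  leading-count X = subst (λ d → Leading X P (D ℤ.* d) (∑ (suc M ^ n) (summand X)))
    (∑∈-𝟙 solution? (box (suc M) m))
    (subst (λ d → Leading X P d (∑ (suc M ^ n) (summand X))) (∑∈-distribˡ D (box (suc M) m) (𝟙 ∘ solution?))
      (subst (Leading X P (∑∈ (box (suc M) m) (λ v → D ℤ.* 𝟙 (solution? v)))) (sym expand)
        (Leading-∑∈ (box (suc M) m) term)))
    where
    P = ∏ n (λ i → X ℤ.^ ys i)
    D = ∏ n (λ i → + (ys i !))
    factor : Vec ℕ m → ℕ → ℕ → ℤ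
    factor v i k = β (ys i) k ℤ.* node X k ℤ.^ dot (al i) v
    term : ∀ v → Leading X P (D ℤ.* 𝟙 (solution? v)) (∏ n (λ i → ∑ (suc M) (factor v i)))
    term v = subst (λ d → Leading X P d (∏ n (λ i → ∑ (suc M) (factor v i))))
      (trans (∏-* n _ _) (cong (ℤ._*_ D) (∏-𝟙 n (λ i → dot (al i) v ℕ.≟ ys i) (solution? v))))
      (Leading-∏ n (λ i i<n → leading-factor X i i<n (dot (al i) v)))
    open ≡-Reasoning
    expand : ∑ (suc M ^ n) (summand X) ≡ ∑∈ (box (suc M) m) (λ v → ∏ n (λ i → ∑ (suc M) (factor v i)))
    expand = begin
      ∑ (suc M ^ n) (summand X)
        ≡⟨ ∑∈-cong (downFrom (suc M ^ n)) (λ K → trans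
             (cong (ℤ._*_ (weight K)) (∏-∑-monomial (suc M) m (power X K)))
             (sym (∑∈-distribˡ (weight K) (box (suc M) m) (monomial (power X K))))) ⟩
      ∑ (suc M ^ n) (λ K → ∑∈ (box (suc M) m) (λ v → weight K ℤ.* monomial (power X K) v))
        ≡⟨ ∑∈-swap (downFrom (suc M ^ n)) (box (suc M) m) _ ⟩
      ∑∈ (box (suc M) m) (λ v → ∑ (suc M ^ n) (λ K → weight K ℤ.* monomial (power X K) v))
        ≡⟨ ∑∈-cong (box (suc M) m) (λ v → trans
             (∑∈-cong (downFrom (suc M ^ n)) (λ K → trans
               (cong (ℤ._*_ (weight K)) (monomial-digits X K v al))
               (sym (∏digits-* n (λ i → β (ys i)) (λ i k → node X k ℤ.^ dot (al i) v) K))))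
             (∑-∏digits n (factor v))) ⟩
      ∑∈ (box (suc M) m) (λ v → ∏ n (λ i → ∑ (suc M) (factor v i))) ∎

-- Bit lengths

infix 4 _⊑_

record _⊑_ (z : ℤ) (b : ℕ) : Set where
  constructor bits
  field abs≤ : ∣ z ∣ ≤ 2 ^ b
open _⊑_

⊑-weaken : ∀ {z a b} → a ≤ b → z ⊑ a → z ⊑ b
⊑-weaken a≤b (bits p) = bits (ℕ.≤-trans p (ℕ.^-monoʳ-≤ 2 a≤b))

⊑-* : ∀ {x y a b} → x ⊑ a → y ⊑ b → x ℤ.* y ⊑ a + b
⊑-* {x} {y} {a} {b} (bits p) (bits q) = bits (begin
  ∣ x ℤ.* y ∣    ≡⟨ ℤ.abs-* x y ⟩
  ∣ x ∣ * ∣ y ∣  ≤⟨ ℕ.*-mono-≤ p q ⟩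
  2 ^ a * 2 ^ b  ≡⟨ ℕ.^-distribˡ-+-* 2 a b ⟨
  2 ^ (a + b)    ∎)
  where open ℕ.≤-Reasoning

double-2^ : ∀ {x y} a → x ≤ 2 ^ a → y ≤ 2 ^ a → x + y ≤ 2 ^ suc a
double-2^ a p q = ℕ.+-mono-≤ p (ℕ.≤-trans q (ℕ.m≤m+n (2 ^ a) 0))

⊑-+ : ∀ {x y a} → x ⊑ a → y ⊑ a → x ℤ.+ y ⊑ suc a
⊑-+ {x} {y} {a} (bits p) (bits q) = bits (ℕ.≤-trans (ℤ.∣i+j∣≤∣i∣+∣j∣ x y) (double-2^ a p q))

⊑-minus : ∀ {x y a} → x ⊑ a → y ⊑ a → x ℤ.- y ⊑ suc a
⊑-minus {x} {y} {a} (bits p) (bits q) = bits (ℕ.≤-trans (ℤ.∣i-j∣≤∣i∣+∣j∣ x y) (double-2^ a p q))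

n<2^n : ∀ n → n < 2 ^ n
n<2^n zero    = s≤s z≤n
n<2^n (suc n) = ℕ.+-mono-≤ (ℕ.m^n>0 2 n) (ℕ.≤-trans (n<2^n n) (ℕ.m≤m+n (2 ^ n) 0))

⊑-pos : ∀ {k b} → k ≤ b → + k ⊑ b
⊑-pos {k} k≤b = ⊑-weaken k≤b (bits (ℕ.<⇒≤ (n<2^n k)))

⊑-0 : ∀ {b} → 0ℤ ⊑ b
⊑-0 = bits z≤n

⊑-1 : ∀ {b} → 1ℤ ⊑ b
⊑-1 {b} = bits (ℕ.m^n>0 2 b)

-- Exact quotients inherit the bound of the dividend. The weights and the numbers of the final
-- extraction are bounded in this way, without estimates of their own.
⊑-cancelˡ : ∀ {d x b} → ∣ d ∣ ≢ 0 → d ℤ.* x ⊑ b → x ⊑ b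
⊑-cancelˡ {d} {x} {b} d≢0 (bits p) = bits (begin
  ∣ x ∣          ≤⟨ ℕ.m≤n*m ∣ x ∣ ∣ d ∣ {{≢-nonZero d≢0}} ⟩
  ∣ d ∣ * ∣ x ∣  ≡⟨ ℤ.abs-* d x ⟨
  ∣ d ℤ.* x ∣    ≤⟨ p ⟩
  2 ^ b          ∎)
  where open ℕ.≤-Reasoning

-- One extra bit because suc ∣ z ∣ may exceed 2 ^ b, another for the sign.
size-bound : ∀ {z b} → z ⊑ b → size z ≤ suc (suc b)
size-bound {z} {b} (bits p) = s≤s (begin
  ⌈log₂ suc ∣ z ∣ ⌉   ≤⟨ ⌈log₂⌉-mono-≤ (double-2^ b (ℕ.m^n>0 2 b) p) ⟩
  ⌈log₂ 2 ^ suc b ⌉   ≡⟨ ⌈log₂2^n⌉≡n (suc b) ⟩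
  suc b               ∎)
  where open ℕ.≤-Reasoning

-- Programs with bounded loops on 21 cells

data Cmd : Set where
  nop                 : Cmd
  _←_⟨_⟩_             : ℕ → Operand → Op → Operand → Cmd
  _▹_                 : Cmd → Cmd → Cmd
  when_≤_then_else_   : Operand → Operand → Cmd → Cmd → Cmd
  repeat              : ℕ → Poly 3 → Cmd → Cmd

infix  5 _←_⟨_⟩_
infixr 4 _▹_

-- The polynomial in `repeat` only bounds the number of rounds; it leaves no trace in the code.
code : Cmd → Program
code nop                        = skip
code (c ← a ⟨ o ⟩ b)            = at c ≔ a ⟨ o ⟩ b
code (p ▹ q)                    = code p ⨾ code q
code (when a ≤ b then p else q) = if a ≤ b then code p else code q
code (repeat c _ p)             = while lit 1ℤ ≤ work (at c) loop code p

copy : ℕ → Operand → Cmd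
copy c a = c ← a ⟨ add ⟩ lit 0ℤ

reset : ℕ → Cmd
reset c = copy c (lit 0ℤ)

decrement : ℕ → Cmd
decrement c = c ← work (at c) ⟨ sub ⟩ lit 1ℤ

-- The body sees the decremented counter, which is then a valid row or column index. Bodies that
-- need t + 1 as a factor use `repeat` and decrement by themselves.
countdown : ℕ → Poly 3 → Cmd → Cmd
countdown c L p = repeat c L (decrement c ▹ p)

-- The unit is `stepTime`. Both branches of a conditional are charged, a sum standing in for the
-- maximum; a loop pays one test per round and the final failing test.
steps : Cmd → Poly 3
steps nop                        = con 1
steps (c ← a ⟨ o ⟩ b)            = con 1
steps (p ▹ q)                    = steps p :+ steps q
steps (when a ≤ b then p else q) = con 1 :+ (steps p :+ steps q)
steps (repeat c B p)             = con 1 :+ B :* (con 1 :+ steps p)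

iterate : ∀ {X : Set} → (ℕ → X → X) → ℕ → X → X
iterate f zero    x = x
iterate f (suc k) x = iterate f k (f k x)

All-read : ∀ {P : ℤ → Set} → P 0ℤ → ∀ {σ} → All P σ → ∀ k → P (read σ k)
All-read p0 []       k       = p0
All-read p0 (p ∷ ps) zero    = p
All-read p0 (p ∷ ps) (suc k) = All-read p0 ps k

All-write : ∀ {P : ℤ → Set} {v} → P 0ℤ → P v → ∀ {σ} → All P σ → ∀ k → All P (write σ k v)
All-write p0 pv []       zero    = pv ∷ []
All-write p0 pv []       (suc k) = p0 ∷ All-write p0 pv [] k
All-write p0 pv (p ∷ ps) zero    = pv ∷ ps
All-write p0 pv (p ∷ ps) (suc k) = p ∷ All-write p0 pv ps k

length-write : ∀ {l v} σ k → length σ ≤ l → k < l → length (write σ k v) ≤ l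
length-write []      zero    σ≤l       k<l       = k<l
length-write []      (suc k) σ≤l       (s≤s k<l) = s≤s (length-write [] k z≤n k<l)
length-write (z ∷ σ) zero    σ≤l       k<l       = σ≤l
length-write (z ∷ σ) (suc k) (s≤s σ≤l) (s≤s k<l) = s≤s (length-write σ k σ≤l k<l)

module Machine (inp : List ℤ) (n m M b : ℕ) (5≤b : 5 ≤ b) where

  open Semantics inp using (value; operandTime; testTime; testSpace; skip; assign; seq; if-yes; if-no; loop; stop)

  -- An assignment costs at most B for its target, 2B for each operand and 2B + B² for the
  -- operation, and tests cost less. The space is that of 21 cells and two scratch operands.
  B stepTime maxSpace : ℕ
  B        = suc (suc b)
  stepTime = 8 * B + B * B
  maxSpace = 21 * B + (B + B)

  record OK (σ : Memory) : Set where
    constructor _,_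
    field
      bounded : All (_⊑ b) σ
      length≤ : length σ ≤ 21
  open OK

  read-bounded : ∀ {σ} → OK σ → ∀ k → read σ k ⊑ b
  read-bounded ok = All-read ⊑-0 (bounded ok)

  memorySize-bound : ∀ {σ} → OK σ → memorySize σ ≤ 21 * B
  memorySize-bound {σ} (σ⊑b , l) = ℕ.≤-trans (go σ⊑b) (ℕ.*-monoˡ-≤ B l)
    where
    go : ∀ {σ} → All (_⊑ b) σ → memorySize σ ≤ length σ * B
    go []       = z≤n
    go (p ∷ ps) = ℕ.+-mono-≤ (size-bound p) (go ps)

  -- The value is left unbounded, since a test may look at an entry of A of any length. `Fetch` adds
  -- the bound that copying and arithmetic require.
  record Peek (σ : Memory) (a : Operand) (v : ℤ) : Set where
    field
      value≡ : value σ a ≡ v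
      time≤  : OK σ → operandTime σ a ≤ B + B
  open Peek

  record Fetch (σ : Memory) (a : Operand) (v : ℤ) : Set where
    field
      peek   : Peek σ a v
      bound  : OK σ → v ⊑ b
  open Fetch

  address-size : ∀ {k} → k < 21 → size (+ k) ≤ B
  address-size {k} k<21 = size-bound {+ k} (⊑-weaken 5≤b (bits (ℕ.≤-trans (ℕ.<⇒≤ k<21) (toWitness {a? = 21 ℕ.≤? 32} tt))))

  const : ∀ {σ} z {_ : True (∣ z ∣ ℕ.≤? 32)} → Fetch σ (lit z) z
  const z {p} = record
    { peek  = record { value≡ = refl ; time≤ = λ _ → z≤n }
    ; bound = λ _ → ⊑-weaken 5≤b (bits (toWitness p)) }

  cell : ∀ {σ} k {_ : True (k ℕ.<? 21)} → Fetch σ (work (at k)) (read σ k)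
  cell k {p} = record
    { peek  = record { value≡ = refl ; time≤ = λ _ → ℕ.≤-trans (address-size (toWitness p)) (ℕ.m≤m+n B B) }
    ; bound = λ ok → read-bounded ok k }

  input-at : ∀ {σ v} k {_ : True (k ℕ.<? 21)} → read inp k ≡ v → v ⊑ b → Fetch σ (input (at k)) v
  input-at k {p} eq v⊑b = record
    { peek  = record { value≡ = eq ; time≤ = λ _ → ℕ.≤-trans (address-size (toWitness p)) (ℕ.m≤m+n B B) }
    ; bound = λ _ → v⊑b }

  peek-via : ∀ {σ v} k {_ : True (k ℕ.<? 21)} → read inp ∣ read σ k ∣ ≡ v → Peek σ (input (via k)) v
  peek-via k {p} eq = record
    { value≡ = eq
    ; time≤  = λ ok → ℕ.+-mono-≤ (address-size (toWitness p)) (size-bound (read-bounded ok k)) }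

  input-via : ∀ {σ v} k {_ : True (k ℕ.<? 21)} → read inp ∣ read σ k ∣ ≡ v → v ⊑ b → Fetch σ (input (via k)) v
  input-via k {p} eq v⊑b = record { peek = peek-via k {p} eq ; bound = λ _ → v⊑b }

  -- The bound on the memory is assumed at the start and returned at the end, so sequential
  -- composition hands it on.
  record Exec (p : Program) (σ τ : Memory) (t : ℕ) : Set where
    field
      exec : OK σ → ∃ λ (r : Run inp p σ τ) → time inp r ≤ t * stepTime × space inp r ≤ maxSpace × OK τ
  open Exec public

  exec-weaken : ∀ {p σ τ t u} → t ≤ u → Exec p σ τ t → Exec p σ τ u
  exec (exec-weaken t≤u e) ok with exec e ok
  ... | r , t≤ , s≤ , ok′ = r , ℕ.≤-trans t≤ (ℕ.*-monoˡ-≤ stepTime t≤u) , s≤ , ok′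

  exec-end : ∀ {p σ τ τ′ t} → τ ≡ τ′ → Exec p σ τ t → Exec p σ τ′ t
  exec-end refl e = e

  exec-skip : ∀ {σ} → Exec skip σ σ 1
  exec exec-skip ok = skip , s≤s z≤n , ℕ.≤-trans (memorySize-bound ok) (ℕ.m≤m+n _ _) , ok

  opTime-bound : ∀ o {u v} → u ⊑ b → v ⊑ b → opTime o u v ≤ (B + B) + B * B
  opTime-bound add p q = ℕ.≤-trans (ℕ.+-mono-≤ (size-bound p) (size-bound q)) (ℕ.m≤m+n _ _)
  opTime-bound sub p q = ℕ.≤-trans (ℕ.+-mono-≤ (size-bound p) (size-bound q)) (ℕ.m≤m+n _ _)
  opTime-bound mul p q = ℕ.≤-trans (ℕ.*-mono-≤ (size-bound p) (size-bound q)) (ℕ.m≤n+m (B * B) (B + B))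
  opTime-bound div p q = ℕ.≤-trans (ℕ.*-mono-≤ (size-bound p) (size-bound q)) (ℕ.m≤n+m (B * B) (B + B))

  exec-assign : ∀ {σ c a o a′ u v} w → c < 21 → Fetch σ a u → Fetch σ a′ v → apply o u v ≡ w → (OK σ → w ⊑ b) →
    Exec (at c ≔ a ⟨ o ⟩ a′) σ (write σ c w) 1
  exec (exec-assign {σ} {c} {a} {o} {a′} {u} {v} w c<21 fa fb eq w⊑b) ok
    with refl ← value≡ (peek fa) | refl ← value≡ (peek fb) | refl ← eq =
      assign , time-bound , space-bound , ok′
    where
    open ℕ.≤-Reasoning hiding (stop)
    ok′ : OK (write σ c w)
    ok′ = All-write ⊑-0 (w⊑b ok) (bounded ok) c , length-write σ c (length≤ ok) c<21
    arith : ∀ B → B + (B + B) + (B + B) + (B + B + B * B) ≤ 1 * (8 * B + B * B)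
    arith B = ℕ.≤-trans (ℕ.m≤m+n _ B) (ℕ.≤-reflexive (eq′ B))
      where
      eq′ : ∀ B → B + (B + B) + (B + B) + (B + B + B * B) + B ≡ 1 * (8 * B + B * B)
      eq′ = ℕ.solve-∀
    time-bound = begin
      size (+ c) + operandTime σ a + operandTime σ a′ + opTime o u v
        ≤⟨ ℕ.+-mono-≤ (ℕ.+-mono-≤ (ℕ.+-mono-≤ (address-size c<21) (time≤ (peek fa) ok)) (time≤ (peek fb) ok))
             (opTime-bound o (bound fa ok) (bound fb ok)) ⟩
      B + (B + B) + (B + B) + (B + B + B * B)
        ≤⟨ arith B ⟩
      1 * stepTime ∎
    space-bound = ℕ.⊔-lub
      (begin
        memorySize σ + size u + size v
          ≤⟨ ℕ.+-mono-≤ (ℕ.+-mono-≤ (memorySize-bound ok) (size-bound (bound fa ok))) (size-bound (bound fb ok)) ⟩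
        21 * B + B + B
          ≡⟨ ℕ.+-assoc (21 * B) B B ⟩
        maxSpace ∎)
      (ℕ.≤-trans (memorySize-bound ok′) (ℕ.m≤m+n _ _))

  exec-seq : ∀ {p q ρ σ τ t u} → Exec p ρ σ t → Exec q σ τ u → Exec (p ⨾ q) ρ τ (t + u)
  exec (exec-seq {t = t} {u} d e) ok with exec d ok
  ... | r , t≤ , s≤ , ok′ with exec e ok′
  ... | r′ , t≤′ , s≤′ , ok″ = seq r r′ ,
    ℕ.≤-trans (ℕ.+-mono-≤ t≤ t≤′) (ℕ.≤-reflexive (sym (ℕ.*-distribʳ-+ stepTime t u))) , ℕ.⊔-lub s≤ s≤′ , ok″

  -- A comparison costs the minimum of the two sizes, so a bound on the right operand suffices.
  testTime-bound : ∀ {σ a a′ u v} → Peek σ a u → Fetch σ a′ v → OK σ → testTime σ a a′ ≤ stepTime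
  testTime-bound {σ} {a} {a′} pa fb ok with refl ← value≡ pa | refl ← value≡ (peek fb) =
    ℕ.≤-trans (ℕ.+-mono-≤ (ℕ.+-mono-≤ (time≤ pa ok) (time≤ (peek fb) ok))
      (ℕ.≤-trans (ℕ.m⊓n≤n (size (value σ a)) (size (value σ a′))) (size-bound (bound fb ok)))) (arith B)
    where
    eq′ : ∀ B → (B + B) + (B + B) + B + (3 * B + B * B) ≡ 8 * B + B * B
    eq′ = ℕ.solve-∀
    arith : ∀ B → (B + B) + (B + B) + B ≤ 8 * B + B * B
    arith B = ℕ.≤-trans (ℕ.m≤m+n _ (3 * B + B * B)) (ℕ.≤-reflexive (eq′ B))

  testSpace-bound : ∀ {σ a a′ u v} → Peek σ a u → Fetch σ a′ v → OK σ → testSpace σ a a′ ≤ maxSpace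
  testSpace-bound {σ} {a} {a′} pa fb ok with refl ← value≡ (peek fb) =
    ℕ.+-mono-≤ (memorySize-bound ok)
      (ℕ.≤-trans (ℕ.m⊓n≤n (size (value σ a)) (size (value σ a′)))
        (ℕ.≤-trans (size-bound (bound fb ok)) (ℕ.m≤m+n B B)))

  exec-if-yes : ∀ {σ τ a a′ u v p q t} → Peek σ a u → Fetch σ a′ v → u ℤ.≤ v → Exec p σ τ t →
    Exec (if a ≤ a′ then p else q) σ τ (suc t)
  exec (exec-if-yes pa fb u≤v e) ok with refl ← value≡ pa | refl ← value≡ (peek fb) | exec e ok
  ... | r , t≤ , s≤ , ok′ = if-yes u≤v r ,
    ℕ.+-mono-≤ (testTime-bound pa fb ok) t≤ , ℕ.⊔-lub (testSpace-bound pa fb ok) s≤ , ok′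

  exec-if-no : ∀ {σ τ a a′ u v p q t} → Peek σ a u → Fetch σ a′ v → ¬ (u ℤ.≤ v) → Exec q σ τ t →
    Exec (if a ≤ a′ then p else q) σ τ (suc t)
  exec (exec-if-no pa fb u≰v e) ok with refl ← value≡ pa | refl ← value≡ (peek fb) | exec e ok
  ... | r , t≤ , s≤ , ok′ = if-no u≰v r ,
    ℕ.+-mono-≤ (testTime-bound pa fb ok) t≤ , ℕ.⊔-lub (testSpace-bound pa fb ok) s≤ , ok′

  -- The memory is a function μ of the counter and an abstract state, which turns the effect of the
  -- loop into a pure `iterate`; Inv carries the numerical bounds. The number of rounds is any k, so
  -- the loop over the grid is covered too.
  exec-loop : ∀ {X : Set} (μ : ℕ → X → Memory) (Inv : ℕ → X → Set) (step : ℕ → X → X) {c p t} →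
    c < 21 → (∀ k x → read (μ k x) c ≡ + k) →
    (∀ k x → Inv (suc k) x → Exec p (μ (suc k) x) (μ k (step k x)) t × Inv k (step k x)) →
    ∀ k x → Inv k x →
    Exec (while lit 1ℤ ≤ work (at c) loop p) (μ k x) (μ 0 (iterate step k x)) (suc (k * suc t)) ×
    Inv 0 (iterate step k x)
  exec-loop μ Inv step {c} {p} {t} c<21 counter body = go
    where
    open ℕ.≤-Reasoning hiding (stop)
    guard : ∀ {k x} → Fetch (μ k x) (work (at c)) (+ k)
    guard {k} {x} = subst (Fetch (μ k x) (work (at c))) (counter k x)
      (record { peek = record { value≡ = refl ; time≤ = λ _ → ℕ.≤-trans (address-size c<21) (ℕ.m≤m+n B B) }
              ; bound = λ ok → read-bounded ok c })
    go : ∀ k x → Inv k x → Exec (while lit 1ℤ ≤ work (at c) loop p) (μ k x) (μ 0 (iterate step k x)) (suc (k * suc t)) ×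
      Inv 0 (iterate step k x)
    proj₁ (go zero x inv) .exec ok = stop (λ 1≤c → case subst (ℤ._≤_ 1ℤ) (counter 0 x) 1≤c of λ { (ℤ.+≤+ ()) }) ,
      ℕ.≤-trans (testTime-bound (peek (const 1ℤ)) guard ok) (ℕ.m≤m+n stepTime 0) ,
      testSpace-bound (peek (const 1ℤ)) guard ok , ok
    proj₂ (go zero x inv) = inv
    proj₁ (go (suc k) x inv) .exec ok with exec (proj₁ (body k x inv)) ok
    ... | r , t≤ , s≤ , ok′ with exec (proj₁ (go k (step k x) (proj₂ (body k x inv)))) ok′
    ... | r′ , t≤′ , s≤′ , ok″ =
      loop (subst (ℤ._≤_ 1ℤ) (sym (counter (suc k) x)) (ℤ.+≤+ (s≤s z≤n))) r r′ ,
      (begin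
        testTime (μ (suc k) x) (lit 1ℤ) (work (at c)) + time inp r + time inp r′
          ≤⟨ ℕ.+-mono-≤ (ℕ.+-mono-≤ (testTime-bound (peek (const 1ℤ)) guard ok) t≤) t≤′ ⟩
        stepTime + t * stepTime + suc (k * suc t) * stepTime
          ≡⟨ arith k t stepTime ⟩
        suc (suc k * suc t) * stepTime ∎) ,
      ℕ.⊔-lub (ℕ.⊔-lub (testSpace-bound (peek (const 1ℤ)) guard ok) s≤) s≤′ , ok″
      where
      arith : ∀ k t C → C + t * C + suc (k * suc t) * C ≡ suc (suc k * suc t) * C
      arith = ℕ.solve-∀
    proj₂ (go (suc k) x inv) = proj₂ (go k (step k x) (proj₂ (body k x inv)))

  record Does (c : Cmd) (σ τ : Memory) : Set where
    constructor does
    field runs : Exec (code c) σ τ (eval₃ (steps c) n m M)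
  open Does public

  nothing : ∀ {σ} → Does nop σ σ
  nothing = does exec-skip

  infixr 5 _⟫_
  _⟫_ : ∀ {c d ρ σ τ} → Does c ρ σ → Does d σ τ → Does (c ▹ d) ρ τ
  does e ⟫ does f = does (exec-seq e f)

  sets : ∀ {σ c a o a′ u v} w {_ : True (c ℕ.<? 21)} → Fetch σ a u → Fetch σ a′ v → apply o u v ≡ w → w ⊑ b →
    Does (c ← a ⟨ o ⟩ a′) σ (write σ c w)
  sets w {c<21} fa fb eq w⊑b = does (exec-assign w (toWitness c<21) fa fb eq (λ _ → w⊑b))

  copies : ∀ {σ c a u} {_ : True (c ℕ.<? 21)} → Fetch σ a u → Does (copy c a) σ (write σ c u)
  copies {u = u} {c<21} fa = does (exec-assign u (toWitness c<21) fa (const 0ℤ) (ℤ.+-identityʳ u) (bound fa))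

  resets : ∀ {σ c} {_ : True (c ℕ.<? 21)} → Does (reset c) σ (write σ c 0ℤ)
  resets {σ} {c} {c<21} = copies {σ} {c} {lit 0ℤ} {0ℤ} {c<21} (const 0ℤ)

  decrements : ∀ {σ k} c {_ : True (c ℕ.<? 21)} → read σ c ≡ + suc k → Does (decrement c) σ (write σ c (+ k))
  decrements {σ} {k} c {c<21} eq = does (exec-assign (+ k) (toWitness c<21) (cell c {c<21}) (const 1ℤ)
    (cong (ℤ._- 1ℤ) eq) (λ ok → bits (ℕ.≤-trans (ℕ.n≤1+n k) (_⊑_.abs≤ (subst (_⊑ b) eq (read-bounded ok c))))))

  chooses-then : ∀ {σ τ a a′ u v p q} → Peek σ a u → Fetch σ a′ v → u ℤ.≤ v → Does p σ τ →
    Does (when a ≤ a′ then p else q) σ τ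
  chooses-then pa fb u≤v (does e) = does (exec-weaken (s≤s (ℕ.m≤m+n _ _)) (exec-if-yes pa fb u≤v e))

  chooses-else : ∀ {σ τ a a′ u v p q} → Peek σ a u → Fetch σ a′ v → ¬ (u ℤ.≤ v) → Does q σ τ →
    Does (when a ≤ a′ then p else q) σ τ
  chooses-else {p = p} pa fb u≰v (does e) =
    does (exec-weaken (s≤s (ℕ.m≤n+m _ (eval₃ (steps p) n m M))) (exec-if-no pa fb u≰v e))

  repeats : ∀ {X : Set} (μ : ℕ → X → Memory) (Inv : ℕ → X → Set) (step : ℕ → X → X) {c L p} {c<21 : True (c ℕ.<? 21)} →
    (∀ k x → read (μ k x) c ≡ + k) →
    (∀ k x → Inv (suc k) x → Does p (μ (suc k) x) (μ k (step k x)) × Inv k (step k x)) →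
    ∀ k x → k ≤ eval₃ L n m M → Inv k x →
    Does (repeat c L p) (μ k x) (μ 0 (iterate step k x)) × Inv 0 (iterate step k x)
  repeats μ Inv step {p = p} {c<21} counter body k x k≤L inv
    with exec-loop μ Inv step (toWitness c<21) counter
           (λ k x i → runs (proj₁ (body k x i)) , proj₂ (body k x i)) k x inv
  ... | e , i = does (exec-weaken (s≤s (ℕ.*-monoˡ-≤ (suc (eval₃ (steps p) n m M)) k≤L)) e) , i

  countdowns : ∀ {X : Set} (μ : ℕ → X → Memory) (Inv : ℕ → X → Set) (step : ℕ → X → X) {c L p} {c<21 : True (c ℕ.<? 21)} →
    (∀ k x → read (μ k x) c ≡ + k) →
    (∀ k x → Inv (suc k) x → Does p (write (μ (suc k) x) c (+ k)) (μ k (step k x)) × Inv k (step k x)) →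
    ∀ k x → k ≤ eval₃ L n m M → Inv k x →
    Does (countdown c L p) (μ k x) (μ 0 (iterate step k x)) × Inv 0 (iterate step k x)
  countdowns μ Inv step {c} {L} {p} {c<21} counter body = repeats μ Inv step {c} {L} {c<21 = c<21} counter
    (λ k x inv → decrements c {c<21} (counter (suc k) x) ⟫ proj₁ (body k x inv) , proj₂ (body k x inv))

-- The counting program

-- T, N, D, Y, X, P are as in the introduction; K is the current grid point, of which r still has to be
-- decomposed into digits k; Wn / Wd is its weight; w is the value of ∏ᵢ zᵢ^aᵢⱼ, z that of a single
-- node, g that of the geometric sum, F that of the whole summand.

#T #N #D #Y #X #P #K #r #q #k #t #i #j #Wn #Wd #F #w #z #g #a #v : ℕ
#T = 0
#N = 1
#D = 2
#Y = 3
#X = 4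
#P = 5
#K = 6
#r = 7
#q = 8
#k = 9
#t = 10
#i = 11
#j = 12
#Wn = 13
#Wd = 14
#F = 15
#w = 16
#z = 17
#g = 18
#a = 19
#v = 20

record State : Set where
  field
    T N D Y X P K r q k t i j Wn Wd F w z g a v : ℤ

mem : State → Memory
mem s = T ∷ N ∷ D ∷ Y ∷ X ∷ P ∷ K ∷ r ∷ q ∷ k ∷ t ∷ i ∷ j ∷ Wn ∷ Wd ∷ F ∷ w ∷ z ∷ g ∷ a ∷ v ∷ []
  where open State s

val : ℕ → Operand
val c = work (at c)

rows columns entries : Operand
rows    = input (at 0)
columns = input (at 1)
entries = input (via #a)

n′ m′ M′ N′ : Poly 3
n′ = var Fin.zero
m′ = var (Fin.suc Fin.zero)
M′ = var (Fin.suc (Fin.suc Fin.zero))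
N′ = con 1 :+ M′

-- The input starts with n and m, hence the offset 2, and y follows the n * m entries of A.
loadY : Cmd
loadY = #a ← rows ⟨ mul ⟩ columns
      ▹ #a ← val #a ⟨ add ⟩ val #i
      ▹ #a ← val #a ⟨ add ⟩ lit (+ 2)
      ▹ copy #v entries

-- The test reads only as many digits of aᵢⱼ as N has, and an entry longer than that is never copied.
loadA : Cmd
loadA = #a ← val #i ⟨ mul ⟩ columns
      ▹ #a ← val #a ⟨ add ⟩ val #j
      ▹ #a ← val #a ⟨ add ⟩ lit (+ 2)
      ▹ when entries ≤ val #N then copy #t entries else copy #t (val #N)

-- Scratch cells are zeroed at the end of each round, so that the memory depends only on the loop
-- counter and the accumulators.
forget : Cmd
forget = reset #a ▹ reset #v

-- If some yᵢ is negative there is no point, since A and x are nonnegative. The flag r then skips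
-- the computation, and cell 0 still holds the answer 0.
signs : Cmd
signs = copy #i rows
      ▹ countdown #i n′
          ( loadY
          ▹ when val #v ≤ lit (-[1+ 0 ]) then copy #r (lit 1ℤ) else nop
          ▹ forget)

maximum : Cmd
maximum = copy #i rows
        ▹ countdown #i n′
            ( loadY
            ▹ when val #v ≤ val #N then nop else copy #N (val #v)
            ▹ forget)
        ▹ #N ← val #N ⟨ add ⟩ lit 1ℤ

factorials : Cmd
factorials = copy #D (lit 1ℤ)
           ▹ copy #i rows
           ▹ countdown #i n′
               ( loadY
               ▹ copy #t (val #v)
               ▹ repeat #t N′
                   ( #D ← val #D ⟨ mul ⟩ val #t
                   ▹ decrement #t)
               ▹ forget)

modulus : Cmd
modulus = copy #Y (lit (+ 2))
        ▹ copy #j columns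
        ▹ countdown #j m′ (#Y ← val #Y ⟨ mul ⟩ val #N)
        ▹ #X ← val #D ⟨ mul ⟩ val #Y

scale : Cmd
scale = copy #P (lit 1ℤ)
      ▹ copy #i rows
      ▹ countdown #i n′
          ( loadY
          ▹ copy #t (val #v)
          ▹ countdown #t N′ (#P ← val #P ⟨ mul ⟩ val #X)
          ▹ forget)

grid : Cmd
grid = copy #K (lit 1ℤ)
     ▹ copy #i rows
     ▹ countdown #i n′ (#K ← val #K ⟨ mul ⟩ val #N)

digit : Cmd
digit = #q ← val #r ⟨ div ⟩ val #N
      ▹ #k ← val #q ⟨ mul ⟩ val #N
      ▹ #k ← val #r ⟨ sub ⟩ val #k
      ▹ copy #r (val #q)
      ▹ reset #q

weights : Cmd
weights = copy #Wn (lit 1ℤ)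
        ▹ copy #Wd (lit 1ℤ)
        ▹ copy #r (val #K)
        ▹ copy #i rows
        ▹ countdown #i n′
            ( digit
            ▹ loadY
            ▹ copy #t (val #k)
            ▹ repeat #t N′
                ( #Wd ← val #Wd ⟨ mul ⟩ val #t
                ▹ decrement #t
                ▹ #w ← val #t ⟨ sub ⟩ val #v
                ▹ #Wn ← val #Wn ⟨ mul ⟩ val #w
                ▹ reset #w)
            ▹ reset #k
            ▹ forget)
        ▹ reset #r
        ▹ #F ← val #Wn ⟨ div ⟩ val #Wd
        ▹ reset #Wn
        ▹ reset #Wd

column : Cmd
column = copy #w (lit 1ℤ)
       ▹ copy #r (val #K)
       ▹ copy #i rows
       ▹ countdown #i n′
           ( digit
           ▹ #z ← lit 0ℤ ⟨ sub ⟩ val #k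
           ▹ #z ← val #z ⟨ mul ⟩ val #X
           ▹ loadA
           ▹ countdown #t N′ (#w ← val #w ⟨ mul ⟩ val #z)
           ▹ reset #z
           ▹ reset #k
           ▹ reset #a)
       ▹ reset #r

-- Horner's rule from g = 0. The closed form would divide by w - 1, which fails for w = 1.
geometric : Cmd
geometric = copy #t (val #N)
          ▹ countdown #t N′
              ( #g ← val #g ⟨ mul ⟩ val #w
              ▹ #g ← val #g ⟨ add ⟩ lit 1ℤ)

round : Cmd
round = decrement #K
      ▹ weights
      ▹ copy #j columns
      ▹ countdown #j m′
          ( column
          ▹ geometric
          ▹ #F ← val #F ⟨ mul ⟩ val #g
          ▹ reset #w
          ▹ reset #g)
      ▹ #T ← val #T ⟨ add ⟩ val #F
      ▹ reset #F

-- The remainder modulo Y is formed with Euclidean division, so it equals the count even if the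
-- cofactor U is negative.
extract : Cmd
extract = #T ← val #T ⟨ div ⟩ val #P
        ▹ #T ← val #T ⟨ div ⟩ val #D
        ▹ #q ← val #T ⟨ div ⟩ val #Y
        ▹ #q ← val #q ⟨ mul ⟩ val #Y
        ▹ #T ← val #T ⟨ sub ⟩ val #q

setup : Cmd
setup = maximum ▹ factorials ▹ modulus ▹ scale ▹ grid

-- The first assignment allocates the 21 cells.
program : Program
program = code (reset #v ▹ signs)
        ⨾ if val #r ≤ lit 0ℤ
            -- The loop over K is not a `repeat`, as its Nⁿ rounds have no polynomial bound.
            then code setup ⨾ (while lit 1ℤ ≤ val #K loop code round) ⨾ code extract
            else skip

-- Bit lengths of the numbers computed

addressᵇ valueᵇ productᵇ modulusᵇ Xᵇ Pᵇ nodeᵇ powerᵇ sumᵇ termᵇ Tᵇ : Poly 3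
addressᵇ = (n′ :* m′) :+ (n′ :+ (m′ :+ con 2))
valueᵇ   = N′
-- For D and for both parts of a weight: n rows with at most N factors, of N bits each.
productᵇ = n′ :* (N′ :* N′)
modulusᵇ = m′ :* N′ :+ con 2
Xᵇ       = productᵇ :+ modulusᵇ
Pᵇ       = n′ :* (N′ :* Xᵇ)
nodeᵇ    = N′ :+ Xᵇ
-- Truncated exponents are at most N; this is where the original size of the entries drops out.
powerᵇ   = n′ :* (N′ :* nodeᵇ)
-- Each Horner round multiplies by w and adds 1, the latter costing one more bit.
sumᵇ     = N′ :* (con 1 :+ powerᵇ)
termᵇ    = m′ :* sumᵇ :+ productᵇ
-- There are Nⁿ summands, and N ≤ 2 ^ M.
Tᵇ       = n′ :* M′ :+ termᵇ

-- The 5 covers the cell addresses and the literals; the last width is for U * Y, the difference of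
-- a Tᵇ-bit and a modulusᵇ-bit number. Their sum serves as a polynomial upper bound for all of them.
widths : List (Poly 3)
widths = con 5 ∷ addressᵇ ∷ valueᵇ ∷ productᵇ ∷ modulusᵇ ∷ Xᵇ ∷ Pᵇ ∷ nodeᵇ ∷ powerᵇ ∷ sumᵇ ∷ termᵇ ∷ Tᵇ ∷
  (con 1 :+ (Tᵇ :+ modulusᵇ)) ∷ []

widthᵇ : Poly 3
widthᵇ = List.foldr _:+_ (con 0) widths

module Width (n m M : ℕ) where

  ⟦_⟧ : Poly 3 → ℕ
  ⟦ p ⟧ = eval₃ p n m M

  width : ℕ
  width = ⟦ widthᵇ ⟧

  width-≤ : ∀ k → ⟦ List.lookup widths k ⟧ ≤ width
  width-≤ = go widths
    where
    go : ∀ ps k → ⟦ List.lookup ps k ⟧ ≤ ⟦ List.foldr _:+_ (con 0) ps ⟧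
    go (p ∷ ps) Fin.zero    = ℕ.m≤m+n _ _
    go (p ∷ ps) (Fin.suc k) = ℕ.≤-trans (go ps k) (ℕ.m≤n+m _ ⟦ p ⟧)

-- The potential of a product loop: x may still be multiplied by e bits.
record Room (b e : ℕ) (x : ℤ) : Set where
  constructor room
  field room≤ : ∣ x ∣ * 2 ^ e ≤ 2 ^ b

room-weaken : ∀ {b e e′ x} → e ≤ e′ → Room b e′ x → Room b e x
room-weaken {x = x} e≤e′ (room p) = room (ℕ.≤-trans (ℕ.*-monoʳ-≤ ∣ x ∣ (ℕ.^-monoʳ-≤ 2 e≤e′)) p)

room-start : ∀ {e x} a → x ⊑ a → Room (e + a) e x
room-start {e} {x} a (bits p) = room (begin
  ∣ x ∣ * 2 ^ e   ≤⟨ ℕ.*-monoˡ-≤ (2 ^ e) p ⟩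
  2 ^ a * 2 ^ e   ≡⟨ ℕ.*-comm (2 ^ a) (2 ^ e) ⟩
  2 ^ e * 2 ^ a   ≡⟨ ℕ.^-distribˡ-+-* 2 e a ⟨
  2 ^ (e + a)     ∎)
  where open ℕ.≤-Reasoning

room-one : ∀ {e} → Room e e 1ℤ
room-one {e} = room (ℕ.≤-reflexive (ℕ.*-identityˡ (2 ^ e)))

room-step : ∀ {b g e x f} → f ⊑ g → Room b (g + e) x → Room b e (x ℤ.* f)
room-step {b} {g} {e} {x} {f} (bits q) (room p) = room (begin
  ∣ x ℤ.* f ∣ * 2 ^ e       ≡⟨ cong (_* 2 ^ e) (ℤ.abs-* x f) ⟩
  ∣ x ∣ * ∣ f ∣ * 2 ^ e     ≤⟨ ℕ.*-monoˡ-≤ (2 ^ e) (ℕ.*-monoʳ-≤ ∣ x ∣ q) ⟩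
  ∣ x ∣ * 2 ^ g * 2 ^ e     ≡⟨ ℕ.*-assoc ∣ x ∣ (2 ^ g) (2 ^ e) ⟩
  ∣ x ∣ * (2 ^ g * 2 ^ e)   ≡⟨ cong (∣ x ∣ *_) (ℕ.^-distribˡ-+-* 2 g e) ⟨
  ∣ x ∣ * 2 ^ (g + e)       ≤⟨ p ⟩
  2 ^ b                     ∎)
  where open ℕ.≤-Reasoning

room-⊑ : ∀ {b e x} → Room b e x → x ⊑ b
room-⊑ {b} {e} {x} (room p) = bits (ℕ.≤-trans (ℕ.m≤m*n ∣ x ∣ (2 ^ e) {{>-nonZero (ℕ.m^n>0 2 e)}}) p)

-- Reading the input and testing the signs of y

flag : ℤ → ℤ → ℤ
flag (+ _)    f = f
flag -[1+ _ ] f = 1ℤ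

module Inputs (inp : List ℤ) (n m M : ℕ) (yz : ℕ → ℤ)
  (n-at : read inp 0 ≡ + n) (m-at : read inp 1 ≡ + m)
  (y-at : ∀ i → i < n → read inp (n * m + i + 2) ≡ yz i)
  (y≤M : ∀ i → i < n → ∣ yz i ∣ ≤ M) where

  open Width n m M public
  open Machine inp n m M width (width-≤ (# 0)) public

  ≤-address : ∀ {l} → l ≤ ⟦ addressᵇ ⟧ → + l ⊑ width
  ≤-address l≤ = ⊑-pos (ℕ.≤-trans l≤ (width-≤ (# 1)))

  get-n : ∀ {σ} → Fetch σ rows (+ n)
  get-n = input-at 0 n-at (≤-address (ℕ.≤-trans (ℕ.m≤m+n n _) (ℕ.m≤n+m _ (n * m))))

  get-m : ∀ {σ} → Fetch σ columns (+ m)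
  get-m = input-at 1 m-at (≤-address (ℕ.≤-trans (ℕ.≤-trans (ℕ.m≤m+n m _) (ℕ.m≤n+m _ n)) (ℕ.m≤n+m _ (n * m))))

  y⊑N : ∀ i → i < n → yz i ⊑ suc M
  y⊑N i i<n = bits (ℕ.≤-trans (y≤M i i<n) (ℕ.≤-trans (ℕ.n≤1+n M) (ℕ.<⇒≤ (n<2^n (suc M)))))

  loadY-does : ∀ s i → i < n → Does loadY (mem (record s { i = + i }))
    (mem (record s { i = + i ; a = + (n * m + i + 2) ; v = yz i }))
  loadY-does s i i<n =
    sets (+ (n * m)) get-n get-m (sym (ℤ.pos-* n m)) (≤-address (ℕ.m≤m+n _ _)) ⟫
    sets (+ (n * m + i)) (cell #a) (cell #i) refl
      (≤-address (ℕ.+-monoʳ-≤ (n * m) (ℕ.≤-trans (ℕ.<⇒≤ i<n) (ℕ.m≤m+n _ _)))) ⟫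
    sets (+ (n * m + i + 2)) (cell #a) (const (+ 2)) refl
      (≤-address (ℕ.≤-trans (ℕ.≤-reflexive (ℕ.+-assoc (n * m) i 2))
        (ℕ.+-monoʳ-≤ (n * m) (ℕ.+-mono-≤ (ℕ.<⇒≤ i<n) (ℕ.m≤n+m 2 m))))) ⟫
    copies (input-via #a (y-at i i<n) (⊑-weaken (width-≤ (# 2)) (y⊑N i i<n)))

  forget-does : ∀ s → Does forget (mem s) (mem (record s { a = 0ℤ ; v = 0ℤ }))
  forget-does s = resets ⟫ resets

  flag-does : ∀ s z → Does (when val #v ≤ lit (-[1+ 0 ]) then copy #r (lit 1ℤ) else nop)
    (mem (record s { v = z })) (mem (record s { v = z ; r = flag z (State.r s) }))
  flag-does s (+ _)    = chooses-else (Fetch.peek (cell #v)) (const -[1+ 0 ]) (λ ()) nothing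
  flag-does s -[1+ _ ] = chooses-then (Fetch.peek (cell #v)) (const -[1+ 0 ]) (ℤ.-≤- z≤n) (copies (const 1ℤ))

  signs-does : ∀ s → Does signs (mem (record s { i = 0ℤ ; a = 0ℤ ; v = 0ℤ }))
    (mem (record s { i = 0ℤ ; a = 0ℤ ; v = 0ℤ ; r = iterate (flag ∘ yz) n (State.r s) }))
  signs-does s = copies get-n ⟫ proj₁ (countdowns μ (λ k _ → k ≤ n) (flag ∘ yz) (λ _ _ → refl)
    (λ k x k<n →
      loadY-does (μ′ k x) k k<n ⟫
      flag-does (record (μ′ k x) { a = + (n * m + k + 2) }) (yz k) ⟫
      forget-does (record (μ′ k x) { a = + (n * m + k + 2) ; v = yz k ; r = flag (yz k) x })
      , ℕ.<⇒≤ k<n) n (State.r s) ℕ.≤-refl ℕ.≤-refl)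
    where
    μ′ : ℕ → ℤ → State
    μ′ k x = record s { i = + k ; a = 0ℤ ; v = 0ℤ ; r = x }
    μ : ℕ → ℤ → Memory
    μ k x = mem (μ′ k x)

-- Values of iterated loops and Euclidean quotients

iterate-cong : ∀ {X : Set} {f g : ℕ → X → X} → (∀ k x → f k x ≡ g k x) → ∀ n x → iterate f n x ≡ iterate g n x
iterate-cong eq zero    x = refl
iterate-cong {f = f} {g} eq (suc n) x = trans (iterate-cong eq n (f n x)) (cong (iterate g n) (eq n x))

iterate-∏ : ∀ f n x → iterate (λ k x → x ℤ.* f k) n x ≡ x ℤ.* ∏ n f
iterate-∏ f zero    x = sym (ℤ.*-identityʳ x)
iterate-∏ f (suc n) x = trans (iterate-∏ f n (x ℤ.* f n)) (ℤ.*-assoc x (f n) (∏ n f))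

iterate-∑ : ∀ f n x → iterate (λ k x → x ℤ.+ f k) n x ≡ x ℤ.+ ∑ n f
iterate-∑ f zero    x = sym (ℤ.+-identityʳ x)
iterate-∑ f (suc n) x = trans (iterate-∑ f n (x ℤ.+ f n)) (ℤ.+-assoc x (f n) (∑ n f))

∏-! : ∀ n → ∏ n (λ t → + suc t) ≡ + (n !)
∏-! zero    = refl
∏-! (suc n) = trans (cong (ℤ._*_ (+ suc n)) (∏-! n)) (sym (ℤ.pos-* (suc n) (n !)))

∏-const : ∀ x n → ∏ n (λ _ → x) ≡ x ℤ.^ n
∏-const x zero    = refl
∏-const x (suc n) = cong (ℤ._*_ x) (∏-const x n)

pos-^ : ∀ a n → (+ a) ℤ.^ n ≡ + (a ^ n)
pos-^ a zero    = refl
pos-^ a (suc n) = trans (cong (ℤ._*_ (+ a)) (pos-^ a n)) (sym (ℤ.pos-* a (a ^ n)))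

room-unfold : ∀ {b x} G e t → Room b (suc t * G + e) x → Room b (G + (t * G + e)) x
room-unfold G e t = room-weaken (ℕ.≤-reflexive (sym (ℕ.+-assoc G (t * G) e)))

-- Both q and the computed quotient satisfy x * e ≤ a < (x + 1) * e, which determines x. No sign of
-- q is assumed.
div-unique : ∀ d q r → r < suc d → apply div (+ r ℤ.+ q ℤ.* + suc d) (+ suc d) ≡ q
div-unique d q r r<d = ℤ.≤-antisym (upper q (a ℤ./ e) (ℤ.≤-<-trans (ℤ.[n/d]*d≤n a e) a<))
  (upper (a ℤ./ e) q (ℤ.≤-<-trans (ℤ.i≤j+i (q ℤ.* e) (+ r))
    (subst (λ p → a ℤ.< ℤ.suc p ℤ.* e) (sym (ℤ.div-pos-is-/ℕ a (suc d))) (ℤ.n<s[n/ℕd]*d a (suc d)))))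
  where
  e = + suc d
  a = + r ℤ.+ q ℤ.* e
  a< : a ℤ.< ℤ.suc q ℤ.* e
  a< = subst (a ℤ.<_) (sym (ℤ.suc-* q e)) (ℤ.+-monoˡ-< (q ℤ.* e) (ℤ.+<+ r<d))
  upper : ∀ x y → y ℤ.* e ℤ.< ℤ.suc x ℤ.* e → y ℤ.≤ x
  upper x y p = subst (y ℤ.≤_) (ℤ.pred-suc x) (ℤ.i<j⇒i≤pred[j] (ℤ.*-cancelʳ-<-nonNeg {y} {ℤ.suc x} e p))

div-mod : ∀ y q r → r < y → apply div (+ r ℤ.+ q ℤ.* + y) (+ y) ≡ q
div-mod (suc d) q r r<y = div-unique d q r r<y

div-exact : ∀ d x → 0ℤ ℤ.< d → apply div (d ℤ.* x) d ≡ x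
div-exact (+ suc d) x _ = trans (cong (λ p → apply div p (+ suc d)) (eq (+ suc d) x)) (div-unique d x 0 (s≤s z≤n))
  where
  eq : ∀ d x → d ℤ.* x ≡ 0ℤ ℤ.+ x ℤ.* d
  eq = solve-∀
div-exact (+ zero) x (ℤ.+<+ ())

*-positive : ∀ {x y} → 0ℤ ℤ.< x → 0ℤ ℤ.< y → 0ℤ ℤ.< x ℤ.* y
*-positive {+ suc x} {+ suc y} _ _ = ℤ.+<+ (s≤s z≤n)
*-positive {+ zero}  (ℤ.+<+ ())
*-positive {+ suc x} {+ zero} _ (ℤ.+<+ ())

∏-positive : ∀ n {f} → (∀ k → 0ℤ ℤ.< f k) → 0ℤ ℤ.< ∏ n f
∏-positive zero    p = ℤ.+<+ (s≤s z≤n)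
∏-positive (suc n) p = *-positive (p n) (∏-positive n p)

^-positive : ∀ {x} n → 0ℤ ℤ.< x → 0ℤ ℤ.< x ℤ.^ n
^-positive zero    p = ℤ.+<+ (s≤s z≤n)
^-positive (suc n) p = *-positive p (^-positive n p)

!-positive : ∀ n → 0ℤ ℤ.< + (n !)
!-positive n = ℤ.+<+ (ℕ.1≤n! n)

positive-abs : ∀ {x} → 0ℤ ℤ.< x → ∣ x ∣ ≢ 0
positive-abs {+ suc x} _ ()
positive-abs {+ zero} (ℤ.+<+ ())

length-product : ∀ {A B C : Set} (f : A → B → C) xs ys →
  length (cartesianProductWith f xs ys) ≡ length xs * length ys
length-product f []       ys = refl
length-product f (x ∷ xs) ys = trans (List.length-++ (List.map (f x) ys))
  (cong₂ _+_ (List.length-map (f x) ys) (length-product f xs ys))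

length-box : ∀ N m → length (box N m) ≡ N ^ m
length-box N zero    = refl
length-box N (suc m) = trans (length-product _∷_ (downFrom N) (box N m))
  (cong₂ _*_ (List.length-downFrom N) (length-box N m))

-- Correctness and bit bounds of the stages

module Stages (inp : List ℤ) (n m M : ℕ) (ys : ℕ → ℕ) (al : ℕ → ℕ → ℕ)
  (n-at : read inp 0 ≡ + n) (m-at : read inp 1 ≡ + m)
  (y-at : ∀ i → i < n → read inp (n * m + i + 2) ≡ + ys i)
  (a-at : ∀ i j → i < n → j < m → ∃ λ a → read inp (i * m + j + 2) ≡ + a × al i j ≡ a ⊓ suc M)
  (ys≤M : ∀ i → i < n → ys i ≤ M) (max≡M : iterate (λ i x → x ⊔ ys i) n 0 ≡ M) where

  open Inputs inp n m M (λ i → + ys i) n-at m-at y-at ys≤M public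
  open Counting n m M al ys ys≤M public

  N₁ : ℕ
  N₁ = suc M

  -- The memory between stages: loop cells are zero, and only T, D, Y, X, P, K and F are taken from
  -- s.
  clean : State → State
  clean s = record s { N = + N₁ ; r = 0ℤ ; q = 0ℤ ; k = 0ℤ ; t = 0ℤ ; i = 0ℤ ; j = 0ℤ ; Wn = 0ℤ ; Wd = 0ℤ
                     ; w = 0ℤ ; z = 0ℤ ; g = 0ℤ ; a = 0ℤ ; v = 0ℤ }

  D₁ Y₁ X₁ P₁ : ℤ
  D₁ = ∏ n (λ i → + (ys i !))
  Y₁ = + 2 ℤ.* (+ N₁) ℤ.^ m
  X₁ = D₁ ℤ.* Y₁
  P₁ = ∏ n (λ i → X₁ ℤ.^ ys i)

  N⊑M : + N₁ ⊑ M
  N⊑M = bits (n<2^n M)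

  N⊑N : + N₁ ⊑ N₁
  N⊑N = ⊑-pos ℕ.≤-refl

  max-does : ∀ s l k → Does (when val #v ≤ val #N then nop else copy #N (val #v))
    (mem (record s { N = + l ; v = + k })) (mem (record s { N = + (l ⊔ k) ; v = + k }))
  max-does s l k with k ℕ.≤? l
  ... | yes k≤l rewrite ℕ.m≥n⇒m⊔n≡m k≤l =
    chooses-then (Fetch.peek (cell #v)) (cell #N) (ℤ.+≤+ k≤l) nothing
  ... | no k≰l rewrite ℕ.m≤n⇒m⊔n≡n (ℕ.≰⇒≥ k≰l) =
    chooses-else (Fetch.peek (cell #v)) (cell #N) (λ { (ℤ.+≤+ k≤l) → k≰l k≤l }) (copies (cell #v))

  maximum-does : ∀ s → Does maximum (mem (record (clean s) { N = 0ℤ })) (mem (clean s))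
  maximum-does s = copies get-n ⟫
    proj₁ (countdowns μ (λ k _ → k ≤ n) (λ k x → x ⊔ ys k) (λ _ _ → refl)
      (λ k x k<n →
        loadY-does (μ′ k x) k k<n ⟫
        max-does (record (μ′ k x) { a = + (n * m + k + 2) }) x (ys k) ⟫
        forget-does (record (μ′ k (x ⊔ ys k)) { a = + (n * m + k + 2) ; v = + ys k })
        , ℕ.<⇒≤ k<n) n 0 ℕ.≤-refl ℕ.≤-refl) ⟫
    sets (+ N₁) (cell #N) (const 1ℤ)
      (cong +_ (trans (cong (_+ 1) max≡M) (ℕ.+-comm M 1))) (⊑-weaken (width-≤ (# 2)) N⊑N)
    where
    μ′ : ℕ → ℕ → State
    μ′ k x = record (clean s) { N = + x ; i = + k }
    μ : ℕ → ℕ → Memory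
    μ k x = mem (μ′ k x)

  ys*-≤ : ∀ {i} G e → i < n → ys i * G + e ≤ N₁ * G + e
  ys*-≤ {i} G e i<n = ℕ.+-monoˡ-≤ e (ℕ.*-monoˡ-≤ G (ℕ.≤-trans (ys≤M i i<n) (ℕ.n≤1+n M)))

  ys≤N : ∀ {i} → i < n → ys i ≤ N₁
  ys≤N {i} i<n = ℕ.≤-trans (ys≤M i i<n) (ℕ.n≤1+n M)

  factorials-does : ∀ s → Does factorials (mem (clean s)) (mem (record (clean s) { D = D₁ })) × D₁ ⊑ ⟦ productᵇ ⟧
  factorials-does s = subst (λ d → Does factorials (mem (clean s)) (mem (record (clean s) { D = d })) × d ⊑ ⟦ productᵇ ⟧)
    value (copies (const 1ℤ) ⟫ copies get-n ⟫ proj₁ loop₁ , room-⊑ (proj₂ (proj₂ loop₁)))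
    where
    -- The reserve of one row: at most N factors of N bits. The inner loop spends N bits per factor.
    G = N₁ * N₁
    μ′ : ℕ → ℤ → State
    μ′ k x = record (clean s) { i = + k ; D = x }
    Inv : ℕ → ℤ → Set
    Inv k x = k ≤ n × Room ⟦ productᵇ ⟧ (k * G) x
    inner : ℕ → ℤ → ℤ
    inner t x = x ℤ.* + suc t
    rows₁ : ∀ k x → k < n → Room ⟦ productᵇ ⟧ (G + k * G) x →
      Does (repeat #t N′ (#D ← val #D ⟨ mul ⟩ val #t ▹ decrement #t))
        (mem (record (μ′ k x) { a = + (n * m + k + 2) ; v = + ys k ; t = + ys k }))
        (mem (record (μ′ k (iterate inner (ys k) x)) { a = + (n * m + k + 2) ; v = + ys k ; t = 0ℤ })) ×
      (0 ≤ N₁ × Room ⟦ productᵇ ⟧ (k * G) (iterate inner (ys k) x))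
    rows₁ k x k<n r = repeats (λ t x → mem (record (μ′ k x) { a = + (n * m + k + 2) ; v = + ys k ; t = + t }))
      (λ t x → t ≤ N₁ × Room ⟦ productᵇ ⟧ (t * N₁ + k * G) x) inner (λ _ _ → refl)
      (λ t x inv → let r′ = room-step (⊑-pos (proj₁ inv)) (room-unfold N₁ (k * G) t (proj₂ inv)) in
        sets (x ℤ.* + suc t) (cell #D) (cell #t) refl (⊑-weaken (width-≤ (# 3)) (room-⊑ r′)) ⟫ decrements #t refl
        , (ℕ.<⇒≤ (proj₁ inv) , r′))
      (ys k) x (ys≤N k<n) (ys≤N k<n , room-weaken (ys*-≤ N₁ (k * G) k<n) r)
    loop₁ = countdowns (λ k x → mem (μ′ k x)) Inv (λ k → iterate inner (ys k)) (λ _ _ → refl)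
      (λ k x inv → let inner₁ = rows₁ k x (proj₁ inv) (proj₂ inv) in
        loadY-does (μ′ k x) k (proj₁ inv) ⟫
        copies (cell #v) ⟫
        proj₁ inner₁ ⟫
        forget-does (record (μ′ k (iterate inner (ys k) x)) { a = + (n * m + k + 2) ; v = + ys k })
        , (ℕ.<⇒≤ (proj₁ inv) , proj₂ (proj₂ inner₁)))
      n 1ℤ ℕ.≤-refl (ℕ.≤-refl , room-one)
    value : iterate (λ k → iterate inner (ys k)) n 1ℤ ≡ D₁
    value = trans (iterate-cong (λ k x → trans (iterate-∏ (λ t → + suc t) (ys k) x) (cong (ℤ._*_ x) (∏-! (ys k)))) n 1ℤ)
      (trans (iterate-∏ (λ k → + (ys k !)) n 1ℤ) (ℤ.*-identityˡ D₁))

  modulus-does : ∀ s → State.D s ≡ D₁ → D₁ ⊑ ⟦ productᵇ ⟧ →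
    Does modulus (mem (clean s)) (mem (record (clean s) { Y = Y₁ ; X = X₁ })) × X₁ ⊑ ⟦ Xᵇ ⟧ × Y₁ ⊑ ⟦ modulusᵇ ⟧
  modulus-does s refl D⊑ = subst (λ y → Does modulus (mem (clean s)) (mem (record (clean s) { Y = y ; X = D₁ ℤ.* y })) ×
      D₁ ℤ.* y ⊑ ⟦ Xᵇ ⟧ × y ⊑ ⟦ modulusᵇ ⟧)
    (trans (iterate-∏ (λ _ → + N₁) m (+ 2)) (cong (ℤ._*_ (+ 2)) (∏-const (+ N₁) m)))
    (copies (const (+ 2)) ⟫ copies get-m ⟫ proj₁ loop₁ ⟫
      sets _ (cell #D) (cell #Y) refl (⊑-weaken (width-≤ (# 5)) X⊑)
    , X⊑ , Y⊑)
    where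
    loop₁ = countdowns (λ k x → mem (record (clean s) { j = + k ; Y = x })) (λ k x → Room ⟦ modulusᵇ ⟧ (k * N₁) x)
      (λ k x → x ℤ.* + N₁) (λ _ _ → refl)
      (λ k x r → sets _ (cell #Y) (cell #N) refl (⊑-weaken (width-≤ (# 4)) (room-⊑ (room-step N⊑N r))) , room-step N⊑N r)
      m (+ 2) ℕ.≤-refl (room-start 2 (⊑-pos ℕ.≤-refl))
    Y⊑ = room-⊑ (proj₂ loop₁)
    X⊑ = ⊑-* D⊑ Y⊑

  scale-does : ∀ s → State.X s ≡ X₁ → X₁ ⊑ ⟦ Xᵇ ⟧ → Does scale (mem (clean s)) (mem (record (clean s) { P = P₁ }))
  scale-does s refl X⊑ = subst (λ x → Does scale (mem (clean s)) (mem (record (clean s) { P = x }))) value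
    (copies (const 1ℤ) ⟫ copies get-n ⟫ proj₁ (countdowns (λ k x → mem (μ′ k x))
      (λ k x → k ≤ n × Room ⟦ Pᵇ ⟧ (k * (N₁ * ⟦ Xᵇ ⟧)) x) (λ k → iterate inner (ys k)) (λ _ _ → refl)
      (λ k x inv → let inner₁ = row k x (proj₁ inv) (proj₂ inv) in
        loadY-does (μ′ k x) k (proj₁ inv) ⟫
        copies (cell #v) ⟫
        proj₁ inner₁ ⟫
        forget-does (record (μ′ k (iterate inner (ys k) x)) { a = + (n * m + k + 2) ; v = + ys k })
        , (ℕ.<⇒≤ (proj₁ inv) , proj₂ inner₁))
      n 1ℤ ℕ.≤-refl (ℕ.≤-refl , room-one)))
    where
    μ′ : ℕ → ℤ → State
    μ′ k x = record (clean s) { i = + k ; P = x }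
    inner : ℕ → ℤ → ℤ
    inner _ x = x ℤ.* X₁
    row : ∀ k x → k < n → Room ⟦ Pᵇ ⟧ (N₁ * ⟦ Xᵇ ⟧ + k * (N₁ * ⟦ Xᵇ ⟧)) x →
      Does (countdown #t N′ (#P ← val #P ⟨ mul ⟩ val #X))
        (mem (record (μ′ k x) { a = + (n * m + k + 2) ; v = + ys k ; t = + ys k }))
        (mem (record (μ′ k (iterate inner (ys k) x)) { a = + (n * m + k + 2) ; v = + ys k ; t = 0ℤ })) ×
      Room ⟦ Pᵇ ⟧ (k * (N₁ * ⟦ Xᵇ ⟧)) (iterate inner (ys k) x)
    row k x k<n r = countdowns (λ t x → mem (record (μ′ k x) { a = + (n * m + k + 2) ; v = + ys k ; t = + t }))
      (λ t x → Room ⟦ Pᵇ ⟧ (t * ⟦ Xᵇ ⟧ + k * (N₁ * ⟦ Xᵇ ⟧)) x) inner (λ _ _ → refl)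
      (λ t x r → let r′ = room-step X⊑ (room-unfold ⟦ Xᵇ ⟧ (k * (N₁ * ⟦ Xᵇ ⟧)) t r) in
        sets (x ℤ.* X₁) (cell #P) (cell #X) refl (⊑-weaken (width-≤ (# 6)) (room-⊑ r′)) , r′)
      (ys k) x (ys≤N k<n) (room-weaken (ys*-≤ ⟦ Xᵇ ⟧ (k * (N₁ * ⟦ Xᵇ ⟧)) k<n) r)
    value : iterate (λ k → iterate inner (ys k)) n 1ℤ ≡ P₁
    value = trans (iterate-cong (λ k x → trans (iterate-∏ (λ _ → X₁) (ys k) x) (cong (ℤ._*_ x) (∏-const X₁ (ys k)))) n 1ℤ)
      (trans (iterate-∏ (λ k → X₁ ℤ.^ ys k) n 1ℤ) (ℤ.*-identityˡ P₁))

  n*M≤width : n * M ≤ width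
  n*M≤width = ℕ.≤-trans (ℕ.m≤m+n (n * M) ⟦ termᵇ ⟧) (width-≤ (# 11))

  grid-does : ∀ s → Does grid (mem (clean s)) (mem (record (clean s) { K = + (N₁ ^ n) })) × + (N₁ ^ n) ⊑ n * M
  grid-does s = subst (λ x → Does grid (mem (clean s)) (mem (record (clean s) { K = x })) × x ⊑ n * M)
    (trans (iterate-∏ (λ _ → + N₁) n 1ℤ) (trans (ℤ.*-identityˡ _) (trans (∏-const (+ N₁) n) (pos-^ N₁ n))))
    (copies (const 1ℤ) ⟫ copies get-n ⟫ proj₁ loop₁ , room-⊑ (proj₂ loop₁))
    where
    loop₁ = countdowns (λ k x → mem (record (clean s) { i = + k ; K = x })) (λ k x → Room (n * M) (k * M) x)
      (λ k x → x ℤ.* + N₁) (λ _ _ → refl)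
      (λ k x r → sets _ (cell #K) (cell #N) refl (⊑-weaken n*M≤width (room-⊑ (room-step N⊑M r))) , room-step N⊑M r)
      n 1ℤ ℕ.≤-refl room-one

  prepared : State → State
  prepared s = record (clean s) { D = D₁ ; Y = Y₁ ; X = X₁ ; P = P₁ ; K = + (N₁ ^ n) }

  record Bounds : Set where
    constructor bounds
    field
      X⊑ : X₁ ⊑ ⟦ Xᵇ ⟧
      Y⊑ : Y₁ ⊑ ⟦ modulusᵇ ⟧
      K⊑ : + (N₁ ^ n) ⊑ n * M

  setup-does : ∀ s → Does setup (mem (record (clean s) { N = 0ℤ })) (mem (prepared s)) × Bounds
  setup-does s = maximum-does s ⟫ proj₁ fact ⟫ proj₁ modu ⟫
    scale-does (record s { D = D₁ ; Y = Y₁ ; X = X₁ }) refl (proj₁ (proj₂ modu)) ⟫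
    proj₁ grid₁
    , bounds (proj₁ (proj₂ modu)) (proj₂ (proj₂ modu)) (proj₂ grid₁)
    where
    grid₁ = grid-does (record s { D = D₁ ; Y = Y₁ ; X = X₁ ; P = P₁ })
    fact = factorials-does s
    modu = modulus-does (record s { D = D₁ }) refl (proj₂ fact)

  open Digits N₁

  ∏digits-positive : ∀ n {φ} → (∀ i k → 0ℤ ℤ.< φ i k) → ∀ K → 0ℤ ℤ.< ∏digits n φ K
  ∏digits-positive zero    p K = ℤ.+<+ (s≤s z≤n)
  ∏digits-positive (suc n) p K = *-positive (p n (K ℕ.% N₁)) (∏digits-positive n p (K ℕ./ N₁))

  digitwise : ∀ {A : Set} → (ℕ → ℕ → A → A) → ℕ → ℕ × A → ℕ × A
  digitwise f i x = proj₁ x ℕ./ N₁ , f i (proj₁ x ℕ.% N₁) (proj₂ x)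

  -- A row loop that strips the lowest digit each round computes a `∏digits`. The view h of the
  -- accumulator lets the weight loop carry two products at once.
  iterate-digitwise : ∀ {A : Set} (h : A → ℤ) (f : ℕ → ℕ → A → A) φ → (∀ i k a → h (f i k a) ≡ h a ℤ.* φ i k) →
    ∀ n x → h (proj₂ (iterate (digitwise f) n x)) ≡ h (proj₂ x) ℤ.* ∏digits n φ (proj₁ x)
  iterate-digitwise h f φ eq zero    x = sym (ℤ.*-identityʳ _)
  iterate-digitwise h f φ eq (suc n) x = trans (iterate-digitwise h f φ eq n (digitwise f n x))
    (trans (cong (ℤ._* ∏digits n φ (proj₁ x ℕ./ N₁)) (eq n (proj₁ x ℕ.% N₁) (proj₂ x)))
      (ℤ.*-assoc (h (proj₂ x)) (φ n (proj₁ x ℕ.% N₁)) _))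

  digit-does : ∀ s ρ → + ρ ⊑ width → Does digit (mem (record s { N = + N₁ ; r = + ρ }))
    (mem (record s { N = + N₁ ; r = + (ρ ℕ./ N₁) ; q = 0ℤ ; k = + (ρ ℕ.% N₁) }))
  digit-does s ρ ρ⊑ =
    sets (+ (ρ ℕ./ N₁)) (cell #r) (cell #N) (ℤ.div-pos-is-/ℕ (+ ρ) N₁) (below (ℕ.m/n≤m ρ N₁)) ⟫
    sets (+ (ρ ℕ./ N₁ * N₁)) (cell #q) (cell #N) (sym (ℤ.pos-* (ρ ℕ./ N₁) N₁)) (below (ℕ.m/n*n≤m ρ N₁)) ⟫
    sets (+ (ρ ℕ.% N₁)) (cell #r) (cell #k) remainder≡ (below (ℕ.m%n≤m ρ N₁)) ⟫
    copies (cell #q) ⟫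
    resets
    where
    below : ∀ {l} → l ≤ ρ → + l ⊑ width
    below l≤ρ = bits (ℕ.≤-trans l≤ρ (_⊑_.abs≤ ρ⊑))
    remainder≡ : + ρ ℤ.- + (ρ ℕ./ N₁ * N₁) ≡ + (ρ ℕ.% N₁)
    remainder≡ = trans (cong (λ x → + x ℤ.- + (ρ ℕ./ N₁ * N₁)) (ℕ.m≡m%n+[m/n]*n ρ N₁))
      (i+j-j≡i (+ (ρ ℕ.% N₁)) (+ (ρ ℕ./ N₁ * N₁)))

  factorStep : ℕ → ℕ → ℤ × ℤ → ℤ × ℤ
  factorStep y t x = proj₁ x ℤ.* (+ t ℤ.- + y) , proj₂ x ℤ.* + suc t

  weightStep : ℕ → ℕ → ℤ × ℤ → ℤ × ℤ
  weightStep i k = iterate (factorStep (ys i)) k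

  iterate-proj₁ : ∀ y k x → proj₁ (iterate (factorStep y) k x) ≡ proj₁ x ℤ.* ∏ k (λ t → + t ℤ.- + y)
  iterate-proj₁ y zero    x = sym (ℤ.*-identityʳ _)
  iterate-proj₁ y (suc k) x = trans (iterate-proj₁ y k (factorStep y k x)) (ℤ.*-assoc (proj₁ x) _ _)

  iterate-proj₂ : ∀ y k x → proj₂ (iterate (factorStep y) k x) ≡ proj₂ x ℤ.* ∏ k (λ t → + suc t)
  iterate-proj₂ y zero    x = sym (ℤ.*-identityʳ _)
  iterate-proj₂ y (suc k) x = trans (iterate-proj₂ y k (factorStep y k x)) (ℤ.*-assoc (proj₂ x) _ _)

  numerators denominators : ℕ → ℤ
  numerators   = ∏digits n (λ i k → ∏ k (λ t → + t ℤ.- + ys i))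
  denominators = ∏digits n (λ _ k → + (k !))

  numerators≡ : ∀ K → numerators K ≡ denominators K ℤ.* weight K
  numerators≡ K = trans (∏digits-cong n (λ i k → β-exact (ys i) k) K)
    (∏digits-* n (λ _ k → + (k !)) (λ i → β (ys i)) K)

  denominators-positive : ∀ K → 0ℤ ℤ.< denominators K
  denominators-positive = ∏digits-positive n (λ _ → !-positive)

  digit≤M : ∀ ρ → ρ ℕ.% N₁ ≤ M
  digit≤M ρ = ℕ.≤-pred (ℕ.m%n<n ρ N₁)

  weights-does : ∀ s K → + K ⊑ width → State.K s ≡ + K →
    Does weights (mem (clean s)) (mem (record (clean s) { F = weight K })) × weight K ⊑ ⟦ productᵇ ⟧
  weights-does s K K⊑ refl =
    copies (const 1ℤ) ⟫ copies (const 1ℤ) ⟫ copies (cell #K) ⟫ copies get-n ⟫ proj₁ loop₁ ⟫ resets ⟫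
    sets (weight K) (cell #Wn) (cell #Wd) quotient≡ (⊑-weaken (width-≤ (# 3)) weight⊑) ⟫ resets ⟫ resets
    , weight⊑
    where
    G = N₁ * N₁
    p = ⟦ productᵇ ⟧
    μ′ : ℕ → ℕ × ℤ × ℤ → State
    μ′ k x = record (clean s) { i = + k ; r = + proj₁ x ; Wn = proj₁ (proj₂ x) ; Wd = proj₂ (proj₂ x) }
    Inv : ℕ → ℕ × ℤ × ℤ → Set
    Inv k x = k ≤ n × + proj₁ x ⊑ width × Room p (k * G) (proj₁ (proj₂ x)) × Room p (k * G) (proj₂ (proj₂ x))
    after : ℕ → ℕ × ℤ × ℤ → ℤ × ℤ → State
    after k x ab = record (μ′ k x)
      { r = + (proj₁ x ℕ./ N₁) ; k = + (proj₁ x ℕ.% N₁) ; a = + (n * m + k + 2) ; v = + ys k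
      ; Wn = proj₁ ab ; Wd = proj₂ ab }
    row : ∀ k x → Inv (suc k) x → _
    row k x inv = repeats (λ t ab → mem (record (after k x ab) { t = + t }))
      (λ t ab → t ≤ N₁ × Room p (t * N₁ + k * G) (proj₁ ab) × Room p (t * N₁ + k * G) (proj₂ ab))
      (factorStep (ys k)) {L = N′} (λ _ _ → refl)
      (λ t ab inv′ →
        let Wn′ = room-step (⊑-minus (⊑-pos (ℕ.≤-pred (proj₁ inv′))) (⊑-pos (ys≤M k (proj₁ inv))))
                    (room-unfold N₁ (k * G) t (proj₁ (proj₂ inv′)))
            Wd′ = room-step (⊑-pos (proj₁ inv′)) (room-unfold N₁ (k * G) t (proj₂ (proj₂ inv′)))
        in
        sets _ (cell #Wd) (cell #t) refl (⊑-weaken (width-≤ (# 3)) (room-⊑ Wd′)) ⟫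
        decrements #t refl ⟫
        sets (+ t ℤ.- + ys k) (cell #t) (cell #v) refl
          (⊑-weaken (width-≤ (# 2)) (⊑-minus (⊑-pos (ℕ.≤-pred (proj₁ inv′))) (⊑-pos (ys≤M k (proj₁ inv))))) ⟫
        sets _ (cell #Wn) (cell #w) refl (⊑-weaken (width-≤ (# 3)) (room-⊑ Wn′)) ⟫
        resets
        , (ℕ.<⇒≤ (proj₁ inv′) , Wn′ , Wd′))
      (proj₁ x ℕ.% N₁) (proj₂ x) (ℕ.<⇒≤ (ℕ.m%n<n (proj₁ x) N₁))
      (ℕ.<⇒≤ (ℕ.m%n<n (proj₁ x) N₁) , room-weaken gauge (proj₁ (proj₂ (proj₂ inv))) , room-weaken gauge (proj₂ (proj₂ (proj₂ inv))))
      where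
      gauge : (proj₁ x ℕ.% N₁) * N₁ + k * G ≤ G + k * G
      gauge = ℕ.+-monoˡ-≤ (k * G) (ℕ.*-monoˡ-≤ N₁ (ℕ.<⇒≤ (ℕ.m%n<n (proj₁ x) N₁)))
    loop₁ = countdowns (λ k x → mem (μ′ k x)) Inv (digitwise weightStep) (λ _ _ → refl)
      (λ k x inv →
        digit-does (μ′ k x) (proj₁ x) (proj₁ (proj₂ inv)) ⟫
        loadY-does (record (after k x (proj₂ x)) { a = 0ℤ ; v = 0ℤ }) k (proj₁ inv) ⟫
        copies (cell #k) ⟫
        proj₁ (row k x inv) ⟫
        resets ⟫
        forget-does (record (after k x (weightStep k (proj₁ x ℕ.% N₁) (proj₂ x))) { k = 0ℤ })
        , (ℕ.<⇒≤ (proj₁ inv) , bits (ℕ.≤-trans (ℕ.m/n≤m (proj₁ x) N₁) (_⊑_.abs≤ (proj₁ (proj₂ inv))))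
        , proj₂ (proj₂ (row k x inv))))
      n (K , 1ℤ , 1ℤ) ℕ.≤-refl (ℕ.≤-refl , K⊑ , room-one , room-one)
    end = iterate (digitwise weightStep) n (K , 1ℤ , 1ℤ)
    Wn≡ : proj₁ (proj₂ end) ≡ denominators K ℤ.* weight K
    Wn≡ = trans (iterate-digitwise proj₁ weightStep _ (λ i → iterate-proj₁ (ys i)) n (K , 1ℤ , 1ℤ))
      (trans (ℤ.*-identityˡ _) (numerators≡ K))
    Wd≡ : proj₂ (proj₂ end) ≡ denominators K
    Wd≡ = trans (iterate-digitwise proj₂ weightStep _
        (λ i k x → trans (iterate-proj₂ (ys i) k x) (cong (ℤ._*_ (proj₂ x)) (∏-! k))) n (K , 1ℤ , 1ℤ))
      (ℤ.*-identityˡ _)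
    quotient≡ : apply div (proj₁ (proj₂ end)) (proj₂ (proj₂ end)) ≡ weight K
    quotient≡ = trans (cong₂ (apply div) Wn≡ Wd≡) (div-exact (denominators K) (weight K) (denominators-positive K))
    weight⊑ : weight K ⊑ p
    weight⊑ = ⊑-cancelˡ {denominators K} (positive-abs (denominators-positive K))
      (subst (_⊑ p) Wn≡ (room-⊑ (proj₁ (proj₂ (proj₂ (proj₂ loop₁))))))

  al≤N : ∀ {i j} → i < n → j < m → al i j ≤ N₁
  al≤N {i} {j} i<n j<m with a-at i j i<n j<m
  ... | a , _ , al≡ = ℕ.≤-trans (ℕ.≤-reflexive al≡) (ℕ.m⊓n≤n a N₁)

  loadA-does : ∀ s i j → i < n → j < m → Does loadA (mem (record s { N = + N₁ ; i = + i ; j = + j }))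
    (mem (record s { N = + N₁ ; i = + i ; j = + j ; a = + (i * m + j + 2) ; t = + al i j }))
  loadA-does s i j i<n j<m =
    sets (+ (i * m)) (cell #i) get-m (sym (ℤ.pos-* i m)) (≤-address (ℕ.≤-trans im≤nm (ℕ.m≤m+n (n * m) _))) ⟫
    sets (+ (i * m + j)) (cell #a) (cell #j) refl
      (≤-address (ℕ.+-mono-≤ im≤nm (ℕ.≤-trans (ℕ.<⇒≤ j<m) (ℕ.≤-trans (ℕ.m≤m+n m 2) (ℕ.m≤n+m (m + 2) n))))) ⟫
    sets (+ (i * m + j + 2)) (cell #a) (const (+ 2)) refl
      (≤-address (ℕ.≤-trans (ℕ.≤-reflexive (ℕ.+-assoc (i * m) j 2))
        (ℕ.+-mono-≤ im≤nm (ℕ.≤-trans (ℕ.+-monoˡ-≤ 2 (ℕ.<⇒≤ j<m)) (ℕ.m≤n+m (m + 2) n))))) ⟫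
    truncated
    where
    im≤nm : i * m ≤ n * m
    im≤nm = ℕ.*-monoˡ-≤ m (ℕ.<⇒≤ i<n)
    s₁ = record s { N = + N₁ ; i = + i ; j = + j ; a = + (i * m + j + 2) }
    truncated : Does (when entries ≤ val #N then copy #t entries else copy #t (val #N))
      (mem s₁) (mem (record s₁ { t = + al i j }))
    truncated with a-at i j i<n j<m
    ... | a , eq , al≡ with a ℕ.≤? N₁
    ...   | yes a≤N rewrite trans al≡ (ℕ.m≤n⇒m⊓n≡m a≤N) =
      -- The test works without a bound on the entry; its success supplies the bound that the copy
      -- needs.
      chooses-then (peek-via #a eq) (cell #N) (ℤ.+≤+ a≤N)
        (copies (input-via #a eq (⊑-pos (ℕ.≤-trans a≤N (width-≤ (# 2))))))
    ...   | no a≰N rewrite trans al≡ (ℕ.m≥n⇒m⊓n≡n (ℕ.≰⇒≥ a≰N)) =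
      chooses-else (peek-via #a eq) (cell #N) (λ { (ℤ.+≤+ a≤N) → a≰N a≤N }) (copies (cell #N))

  column-does : ∀ s K j → j < m → + K ⊑ width → X₁ ⊑ ⟦ Xᵇ ⟧ → State.K s ≡ + K → State.X s ≡ X₁ →
    Does column (mem (record (clean s) { j = + j })) (mem (record (clean s) { j = + j ; w = power X₁ K j })) ×
    power X₁ K j ⊑ ⟦ powerᵇ ⟧
  column-does s K j j<m K⊑ X⊑ refl refl =
    subst (λ x → Does column (mem (record (clean s) { j = + j })) (mem (record (clean s) { j = + j ; w = x })) ×
        x ⊑ ⟦ powerᵇ ⟧)
      (trans (iterate-digitwise id multiply _
          (λ i k x → trans (iterate-∏ (λ _ → node X₁ k) (al i j) x) (cong (ℤ._*_ x) (∏-const (node X₁ k) (al i j))))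
          n (K , 1ℤ))
        (ℤ.*-identityˡ _))
      (copies (const 1ℤ) ⟫ copies (cell #K) ⟫ copies get-n ⟫ proj₁ loop₁ ⟫ resets
      , room-⊑ (proj₂ (proj₂ (proj₂ loop₁))))
    where
    p = ⟦ powerᵇ ⟧
    G = N₁ * ⟦ nodeᵇ ⟧
    multiply : ℕ → ℕ → ℤ → ℤ
    multiply i k = iterate (λ _ x → x ℤ.* node X₁ k) (al i j)
    μ′ : ℕ → ℕ × ℤ → State
    μ′ k x = record (clean s) { i = + k ; j = + j ; r = + proj₁ x ; w = proj₂ x }
    after : ℕ → ℕ × ℤ → ℤ → State
    after k x w = record (μ′ k x)
      { r = + (proj₁ x ℕ./ N₁) ; k = + (proj₁ x ℕ.% N₁) ; z = node X₁ (proj₁ x ℕ.% N₁) ; w = w }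
    minus⊑ : ∀ ρ → 0ℤ ℤ.- + (ρ ℕ.% N₁) ⊑ N₁
    minus⊑ ρ = ⊑-minus ⊑-0 (⊑-pos (digit≤M ρ))
    node⊑ : ∀ ρ → node X₁ (ρ ℕ.% N₁) ⊑ ⟦ nodeᵇ ⟧
    node⊑ ρ = ⊑-* (minus⊑ ρ) X⊑
    Inv : ℕ → ℕ × ℤ → Set
    Inv k x = k ≤ n × + proj₁ x ⊑ width × Room p (k * G) (proj₂ x)
    row : ∀ k x → Inv (suc k) x → _
    row k x inv = countdowns (λ t w → mem (record (after k x w) { a = + (k * m + j + 2) ; t = + t }))
      (λ t w → Room p (t * ⟦ nodeᵇ ⟧ + k * G) w) (λ _ w → w ℤ.* node X₁ (proj₁ x ℕ.% N₁)) {L = N′} (λ _ _ → refl)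
      (λ t w room₁ → let room₂ = room-step (node⊑ (proj₁ x)) (room-unfold ⟦ nodeᵇ ⟧ (k * G) t room₁) in
        sets _ (cell #w) (cell #z) refl (⊑-weaken (width-≤ (# 8)) (room-⊑ room₂)) , room₂)
      (al k j) (proj₂ x) (al≤N (proj₁ inv) j<m)
      (room-weaken (ℕ.+-monoˡ-≤ (k * G) (ℕ.*-monoˡ-≤ ⟦ nodeᵇ ⟧ (al≤N (proj₁ inv) j<m))) (proj₂ (proj₂ inv)))
    loop₁ = countdowns (λ k x → mem (μ′ k x)) Inv (digitwise multiply) (λ _ _ → refl)
      (λ k x inv →
        digit-does (μ′ k x) (proj₁ x) (proj₁ (proj₂ inv)) ⟫
        sets (0ℤ ℤ.- + (proj₁ x ℕ.% N₁)) (const 0ℤ) (cell #k) refl (⊑-weaken (width-≤ (# 2)) (minus⊑ (proj₁ x))) ⟫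
        sets (node X₁ (proj₁ x ℕ.% N₁)) (cell #z) (cell #X) refl (⊑-weaken (width-≤ (# 7)) (node⊑ (proj₁ x))) ⟫
        loadA-does (after k x (proj₂ x)) k j (proj₁ inv) j<m ⟫
        proj₁ (row k x inv) ⟫
        resets ⟫ resets ⟫ resets
        , (ℕ.<⇒≤ (proj₁ inv) , bits (ℕ.≤-trans (ℕ.m/n≤m (proj₁ x) N₁) (_⊑_.abs≤ (proj₁ (proj₂ inv)))) , proj₂ (row k x inv)))
      n (K , 1ℤ) ℕ.≤-refl (ℕ.≤-refl , K⊑ , room-one)

  horner : ℤ → ℕ → ℤ → ℤ
  horner w _ g = g ℤ.* w ℤ.+ 1ℤ

  iterate-horner : ∀ w k g → iterate (horner w) k g ≡ g ℤ.* w ℤ.^ k ℤ.+ ∑ k (ℤ._^_ w)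
  iterate-horner w zero    g = sym (trans (ℤ.+-identityʳ _) (ℤ.*-identityʳ g))
  iterate-horner w (suc k) g = trans (iterate-horner w k (g ℤ.* w ℤ.+ 1ℤ)) (eq g w (w ℤ.^ k) _)
    where
    eq : ∀ g w p s → (g ℤ.* w ℤ.+ 1ℤ) ℤ.* p ℤ.+ s ≡ g ℤ.* (w ℤ.* p) ℤ.+ (p ℤ.+ s)
    eq = solve-∀

  geometric-does : ∀ s w → State.w s ≡ w → w ⊑ ⟦ powerᵇ ⟧ → Does geometric (mem (record s { N = + N₁ ; g = 0ℤ }))
    (mem (record s { N = + N₁ ; t = 0ℤ ; g = ∑ N₁ (ℤ._^_ w) })) × ∑ N₁ (ℤ._^_ w) ⊑ ⟦ sumᵇ ⟧
  geometric-does s w refl w⊑ =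
    subst (λ x → Does geometric (mem (record s { N = + N₁ ; g = 0ℤ })) (mem (record s { N = + N₁ ; t = 0ℤ ; g = x })) ×
        x ⊑ ⟦ sumᵇ ⟧)
      (trans (iterate-horner w N₁ 0ℤ) (ℤ.+-identityˡ _))
      (copies (cell #N) ⟫ proj₁ loop₁
      , inv≤ (proj₂ loop₁))
    where
    p = ⟦ powerᵇ ⟧
    Inv : ℕ → ℤ → Set
    -- The additions rule out a multiplicative reserve, so bits are counted upwards: suc p for each
    -- finished round.
    Inv k x = ∃ λ done → done + k ≡ N₁ × x ⊑ done * suc p
    product⊑ : ∀ {k x} (inv : Inv k x) → x ℤ.* w ⊑ proj₁ inv * suc p + p
    product⊑ (_ , _ , x⊑) = ⊑-* x⊑ w⊑
    next : ∀ k x → Inv (suc k) x → Inv k (horner w k x)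
    next k x (done , eq , x⊑) = suc done , trans (sym (ℕ.+-suc done k)) eq ,
      ⊑-weaken (ℕ.≤-reflexive (cong suc (ℕ.+-comm (done * suc p) p))) (⊑-+ (⊑-* x⊑ w⊑) ⊑-1)
    inv≤ : ∀ {k x} → Inv k x → x ⊑ ⟦ sumᵇ ⟧
    inv≤ {k} (done , eq , x⊑) = ⊑-weaken (ℕ.*-monoˡ-≤ (suc p) (ℕ.≤-trans (ℕ.m≤m+n done k) (ℕ.≤-reflexive eq))) x⊑
    loop₁ = countdowns (λ k x → mem (record s { N = + N₁ ; t = + k ; g = x })) Inv (horner w) {L = N′} (λ _ _ → refl)
      (λ k x inv →
        sets (x ℤ.* w) (cell #g) (cell #w) refl
          (⊑-weaken (ℕ.≤-trans (ℕ.≤-trans (ℕ.≤-reflexive (ℕ.+-comm (proj₁ inv * suc p) p)) (ℕ.n≤1+n _))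
            (ℕ.≤-trans (ℕ.*-monoˡ-≤ (suc p) (ℕ.≤-trans (ℕ.m≤m+n (suc (proj₁ inv)) k)
              (ℕ.≤-reflexive (trans (sym (ℕ.+-suc (proj₁ inv) k)) (proj₁ (proj₂ inv)))))) (width-≤ (# 9))))
            (product⊑ inv)) ⟫
        sets (horner w k x) (cell #g) (const 1ℤ) refl (⊑-weaken (width-≤ (# 9)) (inv≤ (next k x inv)))
        , next k x inv)
      N₁ 0ℤ ℕ.≤-refl (0 , refl , ⊑-0)

  -- The bound on T is an additive potential: each summand still to come reserves 2 ^ termᵇ.
  round-does : ∀ s K T → + K ⊑ width → X₁ ⊑ ⟦ Xᵇ ⟧ → State.X s ≡ X₁ → ∣ T ∣ + suc K * 2 ^ ⟦ termᵇ ⟧ ≤ 2 ^ ⟦ Tᵇ ⟧ →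
    Does round (mem (record (clean s) { T = T ; K = + suc K ; F = 0ℤ }))
      (mem (record (clean s) { T = T ℤ.+ summand X₁ K ; K = + K ; F = 0ℤ })) ×
    ∣ T ℤ.+ summand X₁ K ∣ + K * 2 ^ ⟦ termᵇ ⟧ ≤ 2 ^ ⟦ Tᵇ ⟧
  round-does s K T K⊑ X⊑ refl T≤ =
    decrements #K refl ⟫ proj₁ wt ⟫ copies get-m ⟫ proj₁ loop₁ ⟫
    sets (T ℤ.+ summand X₁ K) (cell #T) (cell #F) (cong (ℤ._+_ T) F≡)
      (⊑-weaken (width-≤ (# 11)) (bits (ℕ.≤-trans (ℕ.m≤m+n _ _) sum≤))) ⟫
    resets
    , sum≤
    where
    s₁ = record s { T = T ; K = + K ; F = 0ℤ }
    wt = weights-does s₁ K K⊑ refl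
    geom : ℕ → ℤ
    geom j = ∑ N₁ (ℤ._^_ (power X₁ K j))
    f = ⟦ termᵇ ⟧
    loop₁ = countdowns (λ j x → mem (record (clean s₁) { j = + j ; F = x }))
      (λ j x → j ≤ m × Room f (j * ⟦ sumᵇ ⟧) x) (λ j x → x ℤ.* geom j) (λ _ _ → refl)
      (λ j x inv →
        let col = column-does (record s₁ { F = x }) K j (proj₁ inv) K⊑ X⊑ refl refl
            geo = geometric-does (record (clean (record s₁ { F = x })) { j = + j ; w = power X₁ K j })
                    (power X₁ K j) refl (proj₂ col)
            room₁ = room-step (proj₂ geo) (proj₂ inv)
        in
        proj₁ col ⟫ proj₁ geo ⟫
        sets (x ℤ.* geom j) (cell #F) (cell #g) refl (⊑-weaken (width-≤ (# 10)) (room-⊑ room₁)) ⟫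
        resets ⟫ resets
        , (ℕ.<⇒≤ (proj₁ inv) , room₁))
      m (weight K) ℕ.≤-refl (ℕ.≤-refl , room-start ⟦ productᵇ ⟧ (proj₂ wt))
    F≡ : iterate (λ j x → x ℤ.* geom j) m (weight K) ≡ summand X₁ K
    F≡ = iterate-∏ geom m (weight K)
    F≤ : ∣ summand X₁ K ∣ ≤ 2 ^ f
    F≤ = _⊑_.abs≤ (subst (_⊑ f) F≡ (room-⊑ (proj₂ (proj₂ loop₁))))
    open ℕ.≤-Reasoning
    sum≤ : ∣ T ℤ.+ summand X₁ K ∣ + K * 2 ^ f ≤ 2 ^ ⟦ Tᵇ ⟧
    sum≤ = begin
      ∣ T ℤ.+ summand X₁ K ∣ + K * 2 ^ f        ≤⟨ ℕ.+-monoˡ-≤ (K * 2 ^ f) (ℤ.∣i+j∣≤∣i∣+∣j∣ T (summand X₁ K)) ⟩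
      ∣ T ∣ + ∣ summand X₁ K ∣ + K * 2 ^ f      ≤⟨ ℕ.+-monoˡ-≤ (K * 2 ^ f) (ℕ.+-monoʳ-≤ ∣ T ∣ F≤) ⟩
      ∣ T ∣ + 2 ^ f + K * 2 ^ f                 ≡⟨ ℕ.+-assoc ∣ T ∣ (2 ^ f) (K * 2 ^ f) ⟩
      ∣ T ∣ + suc K * 2 ^ f                     ≤⟨ T≤ ⟩
      2 ^ ⟦ Tᵇ ⟧                                ∎

  count : ℕ
  count = length solutions

  D-positive : 0ℤ ℤ.< D₁
  D-positive = ∏-positive n (λ i → !-positive (ys i))

  Y-positive : 0ℤ ℤ.< Y₁
  Y-positive = *-positive {+ 2} (ℤ.+<+ (s≤s z≤n)) (^-positive m (ℤ.+<+ (s≤s z≤n)))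

  P-positive : 0ℤ ℤ.< P₁
  P-positive = ∏-positive n (λ i → ^-positive (ys i) (*-positive D-positive Y-positive))

  Y≡ : Y₁ ≡ + (2 * N₁ ^ m)
  Y≡ = trans (cong (ℤ._*_ (+ 2)) (pos-^ N₁ m)) (sym (ℤ.pos-* 2 (N₁ ^ m)))

  -- The solutions lie in a box of N ^ m vectors. The factor 2 makes the bound strict, as a
  -- remainder requires; for m = 0 the count can be N ^ m.
  count<Y : count < 2 * N₁ ^ m
  count<Y = ℕ.<-≤-trans (ℕ.≤-<-trans
    (ℕ.≤-trans (List.length-filter solution? (box N₁ m)) (ℕ.≤-reflexive (length-box N₁ m)))
    (ℕ.m<m+n (N₁ ^ m) (ℕ.m^n>0 N₁ m))) (ℕ.+-monoʳ-≤ (N₁ ^ m) (ℕ.m≤m+n (N₁ ^ m) 0))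

  -- As X = D Y, the bracket is D (c + U Y), so both divisions are exact. U is bounded backwards: T
  -- bounds c + U Y by cancellation, subtracting c bounds U Y, and cancelling Y bounds U.
  extract-does : ∀ s U → Bounds → P₁ ℤ.* (D₁ ℤ.* + count ℤ.+ X₁ ℤ.* U) ⊑ ⟦ Tᵇ ⟧ →
    Does extract (mem (record (prepared s) { T = P₁ ℤ.* (D₁ ℤ.* + count ℤ.+ X₁ ℤ.* U) ; K = 0ℤ }))
      (mem (record (prepared s) { T = + count ; K = 0ℤ ; q = U ℤ.* Y₁ }))
  extract-does s U bnd T⊑ =
    sets (D₁ ℤ.* V) (cell #T) (cell #P) (trans (cong (λ x → apply div (P₁ ℤ.* x) P₁) (factor D₁ (+ count) Y₁ U))
      (div-exact P₁ (D₁ ℤ.* V) P-positive)) (⊑-weaken (width-≤ (# 11)) DV⊑) ⟫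
    sets V (cell #T) (cell #D) (div-exact D₁ V D-positive) (⊑-weaken (width-≤ (# 11)) V⊑) ⟫
    sets U (cell #T) (cell #Y) (subst (λ y → apply div (+ count ℤ.+ U ℤ.* y) y ≡ U) (sym Y≡) (div-mod (2 * N₁ ^ m) U count count<Y))
      (⊑-weaken (width-≤ (# 12)) U⊑) ⟫
    sets (U ℤ.* Y₁) (cell #q) (cell #Y) refl (⊑-weaken (width-≤ (# 12)) UY⊑) ⟫
    sets (+ count) (cell #T) (cell #q) (i+j-j≡i (+ count) (U ℤ.* Y₁)) (⊑-weaken (width-≤ (# 4)) count⊑)
    where
    V = + count ℤ.+ U ℤ.* Y₁
    factor : ∀ d c y u → d ℤ.* c ℤ.+ (d ℤ.* y) ℤ.* u ≡ d ℤ.* (c ℤ.+ u ℤ.* y)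
    factor = solve-∀
    cancel : ∀ a b → (a ℤ.+ b) ℤ.- a ≡ b
    cancel = solve-∀
    DV⊑ : D₁ ℤ.* V ⊑ ⟦ Tᵇ ⟧
    DV⊑ = ⊑-cancelˡ {P₁} (positive-abs P-positive)
      (subst (λ x → P₁ ℤ.* x ⊑ ⟦ Tᵇ ⟧) (factor D₁ (+ count) Y₁ U) T⊑)
    V⊑ : V ⊑ ⟦ Tᵇ ⟧
    V⊑ = ⊑-cancelˡ {D₁} (positive-abs D-positive) DV⊑
    count⊑ : + count ⊑ ⟦ modulusᵇ ⟧
    count⊑ = bits (ℕ.≤-trans (ℕ.<⇒≤ count<Y) (_⊑_.abs≤ (subst (_⊑ ⟦ modulusᵇ ⟧) Y≡ (Bounds.Y⊑ bnd))))
    UY⊑ : U ℤ.* Y₁ ⊑ suc (⟦ Tᵇ ⟧ + ⟦ modulusᵇ ⟧)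
    UY⊑ = subst (_⊑ suc (⟦ Tᵇ ⟧ + ⟦ modulusᵇ ⟧)) (cancel (+ count) (U ℤ.* Y₁))
      (⊑-minus (⊑-weaken (ℕ.m≤m+n ⟦ Tᵇ ⟧ ⟦ modulusᵇ ⟧) V⊑) (⊑-weaken (ℕ.m≤n+m ⟦ modulusᵇ ⟧ ⟦ Tᵇ ⟧) count⊑))
    U⊑ : U ⊑ suc (⟦ Tᵇ ⟧ + ⟦ modulusᵇ ⟧)
    U⊑ = ⊑-cancelˡ {Y₁} (positive-abs Y-positive) (subst (_⊑ suc (⟦ Tᵇ ⟧ + ⟦ modulusᵇ ⟧)) (ℤ.*-comm U Y₁) UY⊑)

  main-exec : ∀ s → ∃ λ τ → read τ 0 ≡ + count ×
    Exec (code setup ⨾ (while lit 1ℤ ≤ val #K loop code round) ⨾ code extract)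
      (mem (record (clean s) { T = 0ℤ ; N = 0ℤ ; F = 0ℤ })) τ
      (⟦ steps setup ⟧ + (suc (N₁ ^ n * suc ⟦ steps round ⟧) + ⟦ steps extract ⟧))
  main-exec s with leading-count X₁
  ... | U , expansion = _ , refl ,
    exec-seq (runs (proj₁ start)) (exec-seq
      (exec-end (cong (λ x → mem (record (prepared s₀) { T = x ; K = 0ℤ })) T≡) (proj₁ loop₁))
      (runs (extract-does s₀ U bnd (subst (_⊑ ⟦ Tᵇ ⟧) T≡ (bits (ℕ.≤-trans (ℕ.≤-reflexive (sym (ℕ.+-identityʳ _))) (proj₂ (proj₂ loop₁))))))))
    where
    s₀ = record s { T = 0ℤ ; F = 0ℤ }
    start = setup-does s₀
    bnd = proj₂ start
    f = ⟦ termᵇ ⟧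
    loop₁ = exec-loop (λ k x → mem (record (prepared s₀) { T = x ; K = + k }))
      (λ k x → k ≤ N₁ ^ n × ∣ x ∣ + k * 2 ^ f ≤ 2 ^ ⟦ Tᵇ ⟧) (λ k x → x ℤ.+ summand X₁ k)
      {p = code round} (toWitness {a? = #K ℕ.<? 21} tt) (λ _ _ → refl)
      (λ k x inv →
        let r = round-does (prepared s₀) k x
                  (⊑-weaken n*M≤width (bits (ℕ.≤-trans (ℕ.<⇒≤ (proj₁ inv)) (_⊑_.abs≤ (Bounds.K⊑ bnd)))))
                  (Bounds.X⊑ bnd) refl (proj₂ inv)
        in runs (proj₁ r) , (ℕ.<⇒≤ (proj₁ inv) , proj₂ r))
      (N₁ ^ n) 0ℤ (ℕ.≤-refl , (begin
        N₁ ^ n * 2 ^ f         ≤⟨ ℕ.*-monoˡ-≤ (2 ^ f) (_⊑_.abs≤ (Bounds.K⊑ bnd)) ⟩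
        2 ^ (n * M) * 2 ^ f    ≡⟨ ℕ.^-distribˡ-+-* 2 (n * M) f ⟨
        2 ^ ⟦ Tᵇ ⟧             ∎))
      where open ℕ.≤-Reasoning
    T≡ : iterate (λ k x → x ℤ.+ summand X₁ k) (N₁ ^ n) 0ℤ ≡ P₁ ℤ.* (D₁ ℤ.* + count ℤ.+ X₁ ℤ.* U)
    T≡ = trans (iterate-∑ (summand X₁) (N₁ ^ n) 0ℤ) (trans (ℤ.+-identityˡ _) expansion)

-- Enumeration of the integer points

unique-lookup : ∀ {A : Set} {xs : List A} → Unique xs → ∀ i j → List.lookup xs i ≡ List.lookup xs j → i ≡ j
unique-lookup (x≢ ∷ u) Fin.zero    Fin.zero    eq = refl
unique-lookup (x≢ ∷ u) Fin.zero    (Fin.suc j) eq = contradiction eq (All.lookup x≢ (∈-lookup j))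
unique-lookup (x≢ ∷ u) (Fin.suc i) Fin.zero    eq = contradiction (sym eq) (All.lookup x≢ (∈-lookup i))
unique-lookup (x≢ ∷ u) (Fin.suc i) (Fin.suc j) eq = cong Fin.suc (unique-lookup u i j eq)

-- A refinement keeps its proof only irrelevantly; decidability recovers a usable proof, from which
-- the index is read off.
enumeration : ∀ {X : Set} {P : X → Set} (P? : ∀ x → Dec (P x)) xs → Unique xs →
  (∀ {x} → P x → x ∈ xs) → (∀ {x} → x ∈ xs → P x) → HasCardinality P (length xs)
enumeration {X} {P} P? xs unique complete sound = mk↔ₛ′ to from
  (λ r → value-injective (sym (Any.lookup-index (complete (witness r)))))
  (λ i → unique-lookup unique _ i (sym (Any.lookup-index (complete (witness (to i))))))
  where
  to : Fin (length xs) → Refinement X P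
  to i = record { value = List.lookup xs i ; proof = Irrelevant.[ sound (∈-lookup i) ] }
  witness : (r : Refinement X P) → P (Refinement.value r)
  witness record { value = x ; proof = Irrelevant.[ p ] } = recompute (P? x) p
  from : Refinement X P → Fin (length xs)
  from r = Any.index (complete (witness r))

integerPoint? : ∀ {n m} (A : Matrix n m) (y : Vec ℤ n) x → Dec (IntegerPoint A y x)
integerPoint? A y x = Vec.≡-dec ℤ._≟_ (A ·ᵥ x) y ×-dec Vec∀.all? (0ℤ ℤ.≤?_) x

embed : ∀ {m} → Vec ℕ m → Vec ℤ m
embed = Vec.map (+_)

embed-injective : ∀ {m} {u v : Vec ℕ m} → embed u ≡ embed v → u ≡ v
embed-injective {u = []}    {[]}    eq = refl
embed-injective {u = x ∷ u} {y ∷ v} eq =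
  cong₂ _∷_ (ℤ.+-injective (Vec.∷-injectiveˡ eq)) (embed-injective (Vec.∷-injectiveʳ eq))

embed-nonnegative : ∀ {m} (v : Vec ℕ m) → Vec∀.All (0ℤ ℤ.≤_) (embed v)
embed-nonnegative []      = Vec∀.[]
embed-nonnegative (x ∷ v) = ℤ.+≤+ z≤n Vec∀.∷ embed-nonnegative v

embed-abs : ∀ {m} {x : Vec ℤ m} → Vec∀.All (0ℤ ℤ.≤_) x → embed (Vec.map ∣_∣ x) ≡ x
embed-abs Vec∀.[]      = refl
embed-abs (p Vec∀.∷ ps) = cong₂ _∷_ (ℤ.0≤i⇒+∣i∣≡i p) (embed-abs ps)

lookup-extensional : ∀ {A : Set} {n} {u v : Vec A n} → (∀ i → Vec.lookup u i ≡ Vec.lookup v i) → u ≡ v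
lookup-extensional {u = []}    {[]}    eq = refl
lookup-extensional {u = x ∷ u} {y ∷ v} eq = cong₂ _∷_ (eq Fin.zero) (lookup-extensional (eq ∘ Fin.suc))

∙-embed : ∀ {m} (row : Vec ℤ m) (f : ℕ → ℕ) → (∀ j → Vec.lookup row j ≡ + f (toℕ j)) → ∀ v →
  row ∙ embed v ≡ + dot f v
∙-embed []        f eq []      = refl
∙-embed (a ∷ row) f eq (x ∷ v) = cong₂ ℤ._+_
  (trans (cong (ℤ._* + x) (eq Fin.zero)) (sym (ℤ.pos-* (f 0) x)))
  (∙-embed row (f ∘ suc) (eq ∘ Fin.suc) v)

dot-term : ∀ {m} f (v : Vec ℕ m) j → f (toℕ j) * Vec.lookup v j ≤ dot f v
dot-term f (x ∷ v) Fin.zero    = ℕ.m≤m+n (f 0 * x) _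
dot-term f (x ∷ v) (Fin.suc j) = ℕ.≤-trans (dot-term (f ∘ suc) v j) (ℕ.m≤n+m _ (f 0 * x))

-- Coefficients exceeding M may be changed: they force the variable to vanish.
dot-truncate : ∀ {m M} f g (v : Vec ℕ m) → (∀ j → f j ≤ M → f j ≡ g j) →
  dot f v ≤ M → dot g v ≡ dot f v
dot-truncate f g []      small d≤M = refl
dot-truncate {M = M} f g (x ∷ v) small d≤M =
  cong₂ _+_ (head x (ℕ.m+n≤o⇒m≤o (f 0 * x) d≤M))
    (dot-truncate (f ∘ suc) (g ∘ suc) v (small ∘ suc) (ℕ.m+n≤o⇒n≤o (f 0 * x) d≤M))
  where
  head : ∀ x → f 0 * x ≤ M → g 0 * x ≡ f 0 * x
  head zero    p = trans (ℕ.*-zeroʳ (g 0)) (sym (ℕ.*-zeroʳ (f 0)))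
  head (suc x) p = cong (_* suc x) (sym (small 0 (ℕ.≤-trans (ℕ.m≤m*n (f 0) (suc x)) p)))

∈-box : ∀ {N m} (v : Vec ℕ m) → (∀ j → Vec.lookup v j < N) → v ∈ box N m
∈-box []      v<N = here refl
∈-box (x ∷ v) v<N = ∈-cartesianProductWith⁺ _∷_ (∈-downFrom⁺ (v<N Fin.zero)) (∈-box v (v<N ∘ Fin.suc))

unique-box : ∀ N m → Unique (box N m)
unique-box N zero    = [] ∷ []
unique-box N (suc m) = Unique.cartesianProductWith⁺ _∷_ Vec.∷-injective (Unique.downFrom⁺ N) (unique-box N m)

read-skip : ∀ {n} (v : Vec ℤ n) rest k → read (Vec.toList v ++ rest) (n + k) ≡ read rest k
read-skip []      rest k = refl
read-skip (x ∷ v) rest k = read-skip v rest k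

read-toList : ∀ {n} (v : Vec ℤ n) rest i → read (Vec.toList v ++ rest) (toℕ i) ≡ Vec.lookup v i
read-toList (x ∷ v) rest Fin.zero    = refl
read-toList (x ∷ v) rest (Fin.suc i) = read-toList v rest i

read-concat : ∀ {n m} (A : Matrix n m) rest i j →
  read (Vec.toList (Vec.concat A) ++ rest) (toℕ i * m + toℕ j) ≡ entry A i j
read-concat {m = m} (row ∷ A) rest i j = trans
  (cong (λ xs → read xs (toℕ i * m + toℕ j)) (trans (cong (_++ rest) (Vec.toList-++ row (Vec.concat A)))
    (List.++-assoc (Vec.toList row) (Vec.toList (Vec.concat A)) rest)))
  (go i)
  where
  go : ∀ i → read (Vec.toList row ++ (Vec.toList (Vec.concat A) ++ rest)) (toℕ i * m + toℕ j) ≡ entry (row ∷ A) i j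
  go Fin.zero    = read-toList row _ j
  go (Fin.suc i) = trans (cong (read (Vec.toList row ++ (Vec.toList (Vec.concat A) ++ rest))) (ℕ.+-assoc m (toℕ i * m) (toℕ j)))
    (trans (read-skip row _ _) (read-concat A rest i j))

read-norm : ∀ {n} (y : Vec ℤ n) i → ∣ read (Vec.toList y) i ∣ ≤ ‖ y ‖∞
read-norm []      i       = z≤n
read-norm (z ∷ y) zero    = ℕ.m≤m⊔n ∣ z ∣ ‖ y ‖∞
read-norm (z ∷ y) (suc i) = ℕ.≤-trans (read-norm y i) (ℕ.m≤n⊔m ∣ z ∣ ‖ y ‖∞)

norm-lub : ∀ {n L} (y : Vec ℤ n) → (∀ i → i < n → ∣ read (Vec.toList y) i ∣ ≤ L) → ‖ y ‖∞ ≤ L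
norm-lub []      bound = z≤n
norm-lub (z ∷ y) bound = ℕ.⊔-lub (bound 0 (s≤s z≤n)) (norm-lub y (λ i i<n → bound (suc i) (s≤s i<n)))

iterate-⊔-≥ : ∀ (f : ℕ → ℕ) n x → x ≤ iterate (λ i x → x ⊔ f i) n x
iterate-⊔-≥ f zero    x = ℕ.≤-refl
iterate-⊔-≥ f (suc n) x = ℕ.≤-trans (ℕ.m≤m⊔n x (f n)) (iterate-⊔-≥ f n (x ⊔ f n))

iterate-⊔-≥f : ∀ (f : ℕ → ℕ) n x i → i < n → f i ≤ iterate (λ i x → x ⊔ f i) n x
iterate-⊔-≥f f (suc n) x i (s≤s i≤n) with ℕ.m≤n⇒m<n∨m≡n i≤n
... | inj₁ i<n  = iterate-⊔-≥f f n (x ⊔ f n) i i<n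
... | inj₂ refl = ℕ.≤-trans (ℕ.m≤n⊔m x (f n)) (iterate-⊔-≥ f n (x ⊔ f n))

iterate-⊔-≤ : ∀ (f : ℕ → ℕ) n x {L} → x ≤ L → (∀ i → f i ≤ L) → iterate (λ i x → x ⊔ f i) n x ≤ L
iterate-⊔-≤ f zero    x x≤L f≤L = x≤L
iterate-⊔-≤ f (suc n) x x≤L f≤L = iterate-⊔-≤ f n (x ⊔ f n) (ℕ.⊔-lub x≤L (f≤L n)) f≤L

flags-1 : ∀ f n → iterate (flag ∘ f) n 1ℤ ≡ 1ℤ
flags-1 f zero    = refl
flags-1 f (suc n) with f n
... | + _      = flags-1 f n
... | -[1+ _ ] = flags-1 f n

flags : ∀ f n → (iterate (flag ∘ f) n 0ℤ ≡ 0ℤ × (∀ i → i < n → + ∣ f i ∣ ≡ f i)) ⊎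
                (iterate (flag ∘ f) n 0ℤ ≡ 1ℤ × ∃ λ i → i < n × ¬ (0ℤ ℤ.≤ f i))
flags f zero    = inj₁ (refl , λ _ ())
flags f (suc n) with f n in eq
... | -[1+ _ ] = inj₂ (flags-1 f n , n , ℕ.≤-refl , λ 0≤f → case subst (0ℤ ℤ.≤_) eq 0≤f of λ ())
... | + k with flags f n
...   | inj₂ (r , i , i<n , neg) = inj₂ (r , i , ℕ.m<n⇒m<1+n i<n , neg)
...   | inj₁ (r , pos) = inj₁ (r , below)
  where
  below : ∀ i → i < suc n → + ∣ f i ∣ ≡ f i
  below i (s≤s i≤n) with ℕ.m≤n⇒m<n∨m≡n i≤n
  ... | inj₁ i<n  = pos i i<n
  ... | inj₂ refl = trans (cong (λ z → + ∣ z ∣) eq) (sym eq)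

-- From an input to its integer points

module Instance {n m : ℕ} (A : Matrix n m) (y : Vec ℤ n) (A≥0 : NonNegative A) (A≢0 : NoZeroColumn A) where

  M : ℕ
  M = ‖ y ‖∞

  inp contents : List ℤ
  inp      = encode A y
  contents = Vec.toList (Vec.concat A) ++ Vec.toList y

  read-contents : ∀ k → read inp (k + 2) ≡ read contents k
  read-contents k = cong (read inp) (ℕ.+-comm k 2)

  yz : ℕ → ℤ
  yz = read (Vec.toList y)

  y-at : ∀ i → i < n → read inp (n * m + i + 2) ≡ yz i
  y-at i _ = trans (read-contents (n * m + i)) (read-skip (Vec.concat A) (Vec.toList y) i)

  lookup-y : ∀ i → Vec.lookup y i ≡ yz (toℕ i)
  lookup-y i = trans (sym (read-toList y [] i)) (cong (λ xs → read xs (toℕ i)) (List.++-identityʳ (Vec.toList y)))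

  coefficient : ℕ → ℕ → ℕ
  coefficient i j = ∣ read contents (i * m + j) ∣

  entry≡ : ∀ i j → entry A i j ≡ + coefficient (toℕ i) (toℕ j)
  entry≡ i j = trans (sym (ℤ.0≤i⇒+∣i∣≡i (A≥0 i j))) (cong (λ z → + ∣ z ∣) (sym (read-concat A (Vec.toList y) i j)))

  -- Truncating at M + 1 and not at M keeps a long entry above every yᵢ, so it still forces its
  -- variable to vanish.
  al : ℕ → ℕ → ℕ
  al i j = coefficient i j ⊓ suc M

  a-at : ∀ i j → i < n → j < m → ∃ λ a → read inp (i * m + j + 2) ≡ + a × al i j ≡ a ⊓ suc M
  a-at i j i<n j<m = coefficient i j , trans (read-contents (i * m + j)) coefficient≡ , refl
    where
    coefficient≡ : read contents (i * m + j) ≡ + coefficient i j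
    coefficient≡ = subst (λ i → read contents (i * m + j) ≡ + coefficient i j) (Fin.toℕ-fromℕ< i<n)
      (subst (λ j → read contents (toℕ (fromℕ< i<n) * m + j) ≡ + coefficient (toℕ (fromℕ< i<n)) j) (Fin.toℕ-fromℕ< j<m)
        (trans (read-concat A (Vec.toList y) _ _) (entry≡ (fromℕ< i<n) (fromℕ< j<m))))

  row≡ : ∀ v i → Vec.lookup (A ·ᵥ embed v) i ≡ + dot (coefficient (toℕ i)) v
  row≡ v i = trans (Vec.lookup-map i (_∙ embed v) A) (∙-embed (Vec.lookup A i) _ (entry≡ i) v)

  point-embed : ∀ {x} → IntegerPoint A y x → ∃ λ v → embed v ≡ x × (∀ i → + dot (coefficient (toℕ i)) v ≡ yz (toℕ i))
  point-embed {x} (Ax≡y , x≥0) = Vec.map ∣_∣ x , embed-abs x≥0 , λ i →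
    trans (sym (row≡ _ i)) (trans (cong (λ u → Vec.lookup (A ·ᵥ u) i) (embed-abs x≥0))
      (trans (cong (λ u → Vec.lookup u i) Ax≡y) (lookup-y i)))

  module Main (y≥0 : ∀ i → i < n → + ∣ yz i ∣ ≡ yz i) where

    ys : ℕ → ℕ
    ys i = ∣ yz i ∣

    max≡M : iterate (λ i x → x ⊔ ys i) n 0 ≡ M
    max≡M = ℕ.≤-antisym (iterate-⊔-≤ ys n 0 z≤n (read-norm y)) (norm-lub y (iterate-⊔-≥f ys n 0))

    open Stages inp n m M ys al refl refl (λ i i<n → trans (y-at i i<n) (sym (y≥0 i i<n))) a-at
      (λ i _ → read-norm y i) max≡M public

    y≡ : ∀ i → Vec.lookup y i ≡ + ys (toℕ i)
    y≡ i = trans (lookup-y i) (sym (y≥0 (toℕ i) (Fin.toℕ<n i)))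

    solution⇒point : ∀ v → Solution v → IntegerPoint A y (embed v)
    solution⇒point v solution = lookup-extensional row , embed-nonnegative v
      where
      row : ∀ i → Vec.lookup (A ·ᵥ embed v) i ≡ Vec.lookup y i
      row i = trans (row≡ v i) (trans (cong +_ (trans
        (dot-truncate (al (toℕ i)) (coefficient (toℕ i)) v same
          (ℕ.≤-trans (ℕ.≤-reflexive (solution (Fin.toℕ<n i))) (read-norm y (toℕ i))))
        (solution (Fin.toℕ<n i)))) (sym (y≡ i)))
        where
        same : ∀ j → al (toℕ i) j ≤ M → al (toℕ i) j ≡ coefficient (toℕ i) j
        same j al≤M with ℕ.⊓-sel (coefficient (toℕ i) j) (suc M)
        ... | inj₁ eq = eq
        -- An entry that was cut equals M + 1 and so is not at most M.
        ... | inj₂ eq = contradiction (subst (_≤ M) eq al≤M) ℕ.1+n≰n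

    equations⇒solution : ∀ v → (∀ i → dot (coefficient (toℕ i)) v ≡ ys (toℕ i)) → v ∈ solutions
    equations⇒solution v equations = ∈-filter⁺ solution? (∈-box v (λ j → s≤s (small j))) λ {i} i<n →
      subst (λ i → dot (al i) v ≡ ys i) (Fin.toℕ-fromℕ< i<n) (truncated (fromℕ< i<n))
      where
      dot≤M : ∀ i → dot (coefficient (toℕ i)) v ≤ M
      dot≤M i = ℕ.≤-trans (ℕ.≤-reflexive (equations i)) (read-norm y (toℕ i))
      truncated : ∀ i → dot (al (toℕ i)) v ≡ ys (toℕ i)
      truncated i = trans (dot-truncate (coefficient (toℕ i)) (al (toℕ i)) v
        (λ j a≤M → sym (ℕ.m≤n⇒m⊓n≡m (ℕ.≤-trans a≤M (ℕ.n≤1+n M)))) (dot≤M i)) (equations i)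
      small : ∀ j → Vec.lookup v j ≤ M
      small j with Fin.¬∀⟶∃¬ n (λ i → entry A i j ≡ 0ℤ) (λ i → entry A i j ℤ.≟ 0ℤ) (A≢0 j)
      ... | i , a≢0 = ℕ.≤-trans (ℕ.m≤n*m (Vec.lookup v j) (coefficient (toℕ i) (toℕ j))
          {{≢-nonZero (λ a≡0 → a≢0 (trans (entry≡ i j) (cong +_ a≡0)))}})
        (ℕ.≤-trans (dot-term (coefficient (toℕ i)) v j) (dot≤M i))

    cardinality : HasCardinality (IntegerPoint A y) count
    cardinality = subst (HasCardinality (IntegerPoint A y)) (List.length-map embed solutions)
      (enumeration (integerPoint? A y) (List.map embed solutions)
        (Unique.map⁺ embed-injective (Unique.filter⁺ solution? (unique-box (suc M) m)))
        complete sound)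
      where
      complete : ∀ {x} → IntegerPoint A y x → x ∈ List.map embed solutions
      complete p with point-embed p
      ... | v , refl , equations = ∈-map⁺ embed (equations⇒solution v
        (λ i → ℤ.+-injective (trans (equations i) (sym (y≥0 (toℕ i) (Fin.toℕ<n i))))))
      sound : ∀ {x} → x ∈ List.map embed solutions → IntegerPoint A y x
      sound x∈ with ∈-map⁻ embed x∈
      ... | v , v∈ , refl = solution⇒point v (proj₂ (∈-filter⁻ solution? {xs = box (suc M) m} v∈))

  no-points : ∀ i → i < n → ¬ (0ℤ ℤ.≤ yz i) → HasCardinality (IntegerPoint A y) 0
  no-points i i<n negative = enumeration (integerPoint? A y) [] [] absurd λ ()
    where
    absurd : ∀ {x} → IntegerPoint A y x → x ∈ []
    absurd p with point-embed p
    ... | v , _ , equations = contradiction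
      (subst (λ i → 0ℤ ℤ.≤ yz i) (Fin.toℕ-fromℕ< i<n)
        (subst (0ℤ ℤ.≤_) (equations (fromℕ< i<n)) (ℤ.+≤+ z≤n)))
      negative

-- Total time and space

prologue : Cmd
prologue = reset #v ▹ signs

cellᵖ stepsᵖ timeᵖ spaceᵖ : Poly 3
cellᵖ  = con 2 :+ widthᵇ
stepsᵖ = steps prologue :+ (steps setup :+ (steps extract :+ (steps round :+ con 3)))
timeᵖ  = stepsᵖ :* (con 8 :* cellᵖ :+ cellᵖ :* cellᵖ)
spaceᵖ = con 21 :* cellᵖ :+ (cellᵖ :+ cellᵖ)

-- As L ≥ 1, the parts executed once may be charged L times. The 3 stands for the sign test, the
-- failing last loop test and the loop test of each round.
steps-bound : ∀ s u e r L → 1 ≤ L → s + suc (u + (suc (L * suc r) + e)) ≤ (s + (u + (e + (r + 3)))) * L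
steps-bound s u e r (suc l) _ = ℕ.≤-trans (ℕ.m≤m+n _ (l * (s + (u + (e + 2))))) (ℕ.≤-reflexive (eq s u e r l))
  where
  eq : ∀ s u e r l → s + suc (u + (suc (suc l * suc r) + e)) + l * (s + (u + (e + 2))) ≡
    (s + (u + (e + (r + 3)))) * suc l
  eq = ℕ.solve-∀

blank : State
blank = record { T = 0ℤ ; N = 0ℤ ; D = 0ℤ ; Y = 0ℤ ; X = 0ℤ ; P = 0ℤ ; K = 0ℤ ; r = 0ℤ ; q = 0ℤ ; k = 0ℤ ; t = 0ℤ
               ; i = 0ℤ ; j = 0ℤ ; Wn = 0ℤ ; Wd = 0ℤ ; F = 0ℤ ; w = 0ℤ ; z = 0ℤ ; g = 0ℤ ; a = 0ℤ ; v = 0ℤ }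

program-exec : ∀ {n m} (A : Matrix n m) y → NonNegative A → NoZeroColumn A →
  let open Width n m ‖ y ‖∞; open Machine (encode A y) n m ‖ y ‖∞ width (width-≤ (# 0)) in
  ∃ λ c → HasCardinality (IntegerPoint A y) c × ∃ λ τ → read τ 0 ≡ + c ×
    Exec program [] τ (⟦ stepsᵖ ⟧ * suc ‖ y ‖∞ ^ n)
program-exec {n} {m} A y A≥0 A≢0 with flags (read (Vec.toList y)) n
... | inj₁ (r≡0 , y≥0) = count , cardinality , proj₁ main , proj₁ (proj₂ main) ,
    exec-weaken (steps-bound ⟦ steps prologue ⟧ ⟦ steps setup ⟧ ⟦ steps extract ⟧ ⟦ steps round ⟧ (suc M ^ n) (ℕ.m^n>0 (suc M) n))
      (exec-seq (exec-end (cong (λ x → mem (record blank { r = x })) r≡0) (runs (resets ⟫ Start.signs-does blank)))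
        (exec-if-yes (Fetch.peek (cell #r)) (const 0ℤ) ℤ.≤-refl (proj₂ (proj₂ main))))
  where
  open Instance A y A≥0 A≢0
  open Main y≥0
  module Start = Inputs inp n m M yz refl refl y-at (λ i _ → read-norm y i)
  main = main-exec blank
... | inj₂ (r≡1 , i , i<n , negative) = 0 , no-points i i<n negative , _ , refl ,
    -- Only the sign test and `skip` follow the prologue; two steps are below the bound for a single
    -- round.
    exec-weaken (ℕ.≤-trans (ℕ.≤-trans (ℕ.+-monoʳ-≤ ⟦ steps prologue ⟧ (s≤s (s≤s z≤n)))
        (steps-bound ⟦ steps prologue ⟧ ⟦ steps setup ⟧ ⟦ steps extract ⟧ ⟦ steps round ⟧ 1 ℕ.≤-refl))
      (ℕ.*-monoʳ-≤ ⟦ stepsᵖ ⟧ (ℕ.m^n>0 (suc M) n)))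
      (exec-seq (exec-end (cong (λ x → mem (record blank { r = x })) r≡1) (runs (resets ⟫ signs-does blank)))
        (exec-if-no (Fetch.peek (cell #r)) (const 0ℤ) (λ { (ℤ.+≤+ ()) }) exec-skip))
  where
  open Instance A y A≥0 A≢0
  open Inputs inp n m M yz refl refl y-at (λ i _ → read-norm y i)

theorem1 : ∃ λ (prog : Program) → ∃₂ λ (p q : Poly 3) →
    ∀ (n m : ℕ) (A : Matrix n m) (y : Vec ℤ n) → NonNegative A → NoZeroColumn A →
    ∃ λ (c : ℕ) → HasCardinality (IntegerPoint A y) c ×
    ∃ λ (comp : Computation prog (encode A y) (+ c)) →
    (runTime comp ≤ eval₃ p n m ‖ y ‖∞ * (‖ y ‖∞ + 1) ^ n) ×
    (runSpace comp ≤ eval₃ q n m ‖ y ‖∞)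
theorem1 = program , timeᵖ , spaceᵖ , λ n m A y A≥0 A≢0 →
  let open Width n m ‖ y ‖∞
      open Machine (encode A y) n m ‖ y ‖∞ width (width-≤ (# 0))
      c , cardinality , τ , output≡ , e = program-exec A y A≥0 A≢0
      run₁ , time≤ , space≤ , _ = exec e ([] , z≤n)
  in c , cardinality , record { run = run₁ ; output = output≡ } ,
     ℕ.≤-trans time≤ (ℕ.≤-reflexive (trans (arrange ⟦ stepsᵖ ⟧ (suc ‖ y ‖∞ ^ n) stepTime)
       (cong (λ N → ⟦ timeᵖ ⟧ * N ^ n) (ℕ.+-comm 1 ‖ y ‖∞)))) ,
     space≤
  where
  arrange : ∀ s L C → s * L * C ≡ s * C * L
  arrange = ℕ.solve-∀
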